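{- For all $k,m\in\mathbb Z$, the restrictions of $\psi_k,\psi^*_k$ to $\mathcal B^{(m)}$ are given by $$\psi_k|_{\mathcal B^{(m)}}=\sum_{p\in\mathbb Z}(-1)^p\,h^{(p)}_{k-m-1}\,D_p\,z,$$ $$\psi^*_k|_{\mathcal B^{(m)}}=(-1)^{k-m+1}\sum_{p\in\mathbb Z}(-1)^p\,e^{(p)}_{k-m+1}\,D^{(-p)}\,z^{ -1},$$ where $h^{(p)}_{k-m-1}$, $e^{(p)}_{k-m+1}$, $z$, $z^{ -1}$ denote multiplication operators.
   Context: Setting. Let $B=\mathbb C[h^{(0)}_1,h^{(0)}_2,\dots]$ be the polynomial ring in independent variables $h^{(0)}_k$ ($k>0$), with $h^{(0)}_0=1$ and $h^{(0)}_k=0$ for $k<0$. $B$ is graded by $\deg h^{(0)}_n=n$, and $B^{\le n}$ is the sum of the homogeneous components of degree $\le n$. Let $\{h^{(r)}_k\}_{k,r\in\mathbb Z}$ be a family of elements of $B$ (extending the $h^{(0)}_k$) with $h^{(r)}_k\in B^{\le k+r}$, $h^{(k)}_{ -k}=1$ for all $k\in\mathbb Z$, and $h^{(r)}_k=0$ whenever $k+r<0$. For an integer vector $\lambda=(\lambda_1,\dots,\lambda_l)$ (parts may be negative and in any order), extended by $\lambda_i=0$ for $i>l$, let $s_\lambda\in B$ be the stable value, for large $N$, of $\det\left[h^{(j-1)}_{\lambda_i-i+1}\right]_{1\le i,j\le N}$ (the value is the same for all $N\ge l$). For partitions these are the generalized Schur functions, and it is required that $\{s_\lambda\}$, $\lambda$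 ranging over all partitions, is a linear basis of $B$. Generalized elementary symmetric functions: for $a,p\in\mathbb Z$, $e^{(p)}_a=0$ if $p<a$, $e^{(p)}_a=1$ if $p=a$, and $e^{(p)}_a=\det\left[h^{(-p+j)}_{p+1-i}\right]_{1\le i,j\le p-a}$ if $p>a$. Let $z$ be a variable, $\mathcal B^{(m)}=z^mB$, $\mathcal B=\bigoplus_{m\in\mathbb Z}\mathcal B^{(m)}=B[z,z^{ -1}]$, with linear basis $\{s_\lambda z^m\}$ ($\lambda$ a partition, $m\in\mathbb Z$). The linear operators $\psi_k,\psi_k^*$ on $\mathcal B$ are defined on this basis by $$\psi_k(s_\lambda z^m)=s_{(k-m-1,\lambda_1,\lambda_2,\dots)}z^{m+1},$$ $$\psi^*_k(s_\lambda z^m)=\sum_{t=1}^\infty(-1)^{t+1}\delta_{k-m-1,\,\lambda_t-t}\;s_{(\lambda_1+1,\dots,\lambda_{t-1}+1,\lambda_{t+1},\lambda_{t+2},\dots)}z^{m-1}.$$ The linear operators $D_p$ and $D^{(p)}$ ($p\in\mathbb Z$) on $B$ are defined on the basis elements $s_\lambda$, $\lambda=(\lambda_1\ge\dots\ge\lambda_l\ge 0)$, by $$D_p(s_\lambda)=\det\left[h^{(j)}_{\lambda_i-i}\right]_{i=1,\dots,l;\;j=0,1,\dots,\widehat p,\dots,l}\ \text{ if }0\le p\le l,\qquad D_p(s_\lambda)=0\ \text{ otherwise}$$ (the column $j=p$ is omitted; this does not depend on appending zero parts to $\lambda$), and $$D^{(p)}(s_\lambda)=\sum_{t=1}^\infty(-1)^{t+1}h^{(p)}_{\lambda_t-t+2}\,s_{(\lambda_1+1,\dots,\lambda_{t-1}+1,\lambda_{t+1},\lambda_{t+2},\dots)},$$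 where $\lambda_t=0$ for $t>l$ (a finite sum). They are extended to $\mathcal B$ by commuting with multiplication by $z^{\pm1}$. When applied to any element, the sums over $p$ in the claim have only finitely many nonzero terms. -}

module Defs where

open import Algebra.Bundles using (CommutativeRing)
import Algebra.Properties.CommutativeMonoid.Sum as MonoidSum
import Algebra.Properties.CommutativeSemigroup as SemigroupProperties
import Algebra.Properties.Group as GroupProperties
import Algebra.Properties.Ring as RingProperties
open import Data.Empty using (⊥-elim)
open import Data.Fin.Base
  using (Fin; zero; suc; toℕ; fromℕ; fromℕ<; inject₁; punchIn)
import Data.Fin.Properties as Finₚ
open import Data.Integer.Base as ℤ
  using (ℤ; +_; -[1+_]; 0ℤ; 1ℤ; -1ℤ; ∣_∣; -_; _-_)
import Data.Integer.Properties as ℤₚ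
import Data.Integer.Tactic.RingSolver as ℤ-Solver
open import Data.List.Base using (List; []; _∷_; _++_; map; length)
import Data.List.Properties as Listₚ
open import Data.List.Relation.Unary.All using (All)
open import Data.List.Relation.Unary.Linked using (Linked)
open import Data.Nat.Base as ℕ using (ℕ; zero; suc; z≤n; s≤s)
import Data.Nat.ListAction as ℕL
import Data.Nat.Properties as ℕₚ
open import Data.Product.Base using (Σ-syntax; _×_; _,_; proj₁; proj₂)
open import Function.Base using (_∘_; id)
open import Level using (Level; _⊔_)
open import Relation.Binary.Definitions using (DecidableEquality)
open import Relation.Binary.PropositionalEquality as ≡ using (_≡_; subst₂)
open import Relation.Nullary using (yes; no; ¬_)

-- Partitions are listed without zero parts, so that distinct elements of
-- the type are distinct partitions.
record Partition : Set where
  constructor mkPartition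
  field
    parts     : List ℕ
    .sorted   : Linked ℕ._≥_ parts
    .positive : All (ℕ._> 0) parts

  vec : List ℤ
  vec = map +_ parts

open Partition public

infix 4 _≟ₚ_

_≟ₚ_ : DecidableEquality Partition
mkPartition xs _ _ ≟ₚ mkPartition ys _ _ with Listₚ.≡-dec ℕₚ._≟_ xs ys
... | yes ≡.refl = yes ≡.refl
... | no  xs≢ys  = no (xs≢ys ∘ ≡.cong parts)

-- λ_{i+1} (positions are counted from 0), with λ_i = 0 beyond the length.
part : List ℤ → ℕ → ℤ
part []       _       = 0ℤ
part (x ∷ _)  zero    = x
part (_ ∷ xs) (suc i) = part xs i

-- remove t λ = (λ_1+1, …, λ_t+1, λ_{t+2}, λ_{t+3}, …).
remove : ℕ → List ℤ → List ℤ
remove zero    []       = []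
remove zero    (_ ∷ xs) = xs
remove (suc t) []       = (0ℤ ℤ.+ 1ℤ) ∷ remove t []
remove (suc t) (x ∷ xs) = (x ℤ.+ 1ℤ) ∷ remove t xs

part-beyond : ∀ xs {i} → length xs ℕ.≤ i → part xs i ≡ 0ℤ
part-beyond []       _         = ≡.refl
part-beyond (_ ∷ xs) (s≤s l≤i) = part-beyond xs l≤i

private
  add-sub : ∀ i j → i ≡ i ℤ.+ j - j
  add-sub = ℤ-Solver.solve-∀

  sub-add : ∀ i j → i - j ℤ.+ j ≡ i
  sub-add = ℤ-Solver.solve-∀

  rearrange : ∀ i j → + 2 ℤ.+ j - i ≡ 0ℤ - i ℤ.+ + 2 ℤ.+ j
  rearrange = ℤ-Solver.solve-∀

module Polynomials {c ℓ : Level} (K : CommutativeRing c ℓ) where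

  private module K = CommutativeRing K

  infix  8 -′_
  infixl 7 _*′_
  infixl 6 _+′_
  infix  4 _≈′_

  -- B is presented as the free commutative K-algebra on the variables:
  -- polynomial expressions modulo the least congruence containing the
  -- commutative ring laws and making K → B a ring homomorphism.
  -- `var n` is the variable h_{n+1}.
  data Expr : Set c where
    con       : K.Carrier → Expr
    var       : ℕ → Expr
    _+′_ _*′_ : Expr → Expr → Expr
    -′_       : Expr → Expr

  data _≈′_ : Expr → Expr → Set (c ⊔ ℓ) where
    refl′    : ∀ {x} → x ≈′ x
    sym′     : ∀ {x y} → x ≈′ y → y ≈′ x
    trans′   : ∀ {x y z} → x ≈′ y → y ≈′ z → x ≈′ z
    +-cong′  : ∀ {x y u v} → x ≈′ y → u ≈′ v → x +′ u ≈′ y +′ v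
    *-cong′  : ∀ {x y u v} → x ≈′ y → u ≈′ v → x *′ u ≈′ y *′ v
    neg-cong′ : ∀ {x y} → x ≈′ y → -′ x ≈′ -′ y
    +-assoc′ : ∀ x y z → (x +′ y) +′ z ≈′ x +′ (y +′ z)
    +-comm′  : ∀ x y → x +′ y ≈′ y +′ x
    +-idˡ′   : ∀ x → con K.0# +′ x ≈′ x
    +-invˡ′  : ∀ x → -′ x +′ x ≈′ con K.0#
    *-assoc′ : ∀ x y z → (x *′ y) *′ z ≈′ x *′ (y *′ z)
    *-comm′  : ∀ x y → x *′ y ≈′ y *′ x
    *-idˡ′   : ∀ x → con K.1# *′ x ≈′ x
    distribˡ′ : ∀ x y z → x *′ (y +′ z) ≈′ x *′ y +′ x *′ z
    con-cong : ∀ {a b} → a K.≈ b → con a ≈′ con b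
    con-+    : ∀ a b → con (a K.+ b) ≈′ con a +′ con b
    con-*    : ∀ a b → con (a K.* b) ≈′ con a *′ con b

  polyRing : CommutativeRing c (c ⊔ ℓ)
  polyRing = record
    { Carrier = Expr
    ; _≈_ = _≈′_
    ; _+_ = _+′_
    ; _*_ = _*′_
    ; -_ = -′_
    ; 0# = con K.0#
    ; 1# = con K.1#
    ; isCommutativeRing = record
      { isRing = record
        { +-isAbelianGroup = record
          { isGroup = record
            { isMonoid = record
              { isSemigroup = record
                { isMagma = record
                  { isEquivalence = record
                    { refl = refl′ ; sym = sym′ ; trans = trans′ }
                  ; ∙-cong = +-cong′
                  }
                ; assoc = +-assoc′
                }
              ; identity = +-idˡ′ , λ x → trans′ (+-comm′ _ _) (+-idˡ′ x)
              }
            ; inverse = +-invˡ′ , λ x → trans′ (+-comm′ _ _) (+-invˡ′ x)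
            ; ⁻¹-cong = neg-cong′
            }
          ; comm = +-comm′
          }
        ; *-cong = *-cong′
        ; *-assoc = *-assoc′
        ; *-identity = *-idˡ′ , λ x → trans′ (*-comm′ _ _) (*-idˡ′ x)
        ; distrib = distribˡ′ , λ x y z →
            trans′ (*-comm′ _ _)
              (trans′ (distribˡ′ x y z) (+-cong′ (*-comm′ _ _) (*-comm′ _ _)))
        }
      ; *-comm = *-comm′
      }
    }

  open CommutativeRing polyRing public
    renaming (Carrier to B; -_ to infix 8 ⊖_)
    using (_≈_; _+_; _*_; 0#; 1#; refl; reflexive; sym; trans; setoid;
           +-cong; +-congˡ; +-congʳ; +-assoc; +-comm; +-identityˡ;
           +-identityʳ; -‿inverseˡ; -‿inverseʳ; -‿cong;
           *-cong; *-congˡ; *-congʳ; *-assoc; *-comm; *-identityˡ;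
           distribˡ; distribʳ; zeroˡ; zeroʳ;
           ring; +-commutativeMonoid;
           +-commutativeSemigroup; *-commutativeSemigroup; +-group)

  open MonoidSum +-commutativeMonoid
    using (sum; sum-cong-≋; sum-replicate-zero; sum-init-last)

  lincomb : ∀ {i} {I : Set i} → (I → B) → List (K.Carrier × I) → B
  lincomb f []            = 0#
  lincomb f ((a , i) ∷ u) = con a * f i + lincomb f u

  coeffAtₚ : Partition → K.Carrier × Partition → K.Carrier
  coeffAtₚ μ (a , ν) with ν ≟ₚ μ
  ... | yes _ = a
  ... | no  _ = K.0#

  -- Total coefficient of μ in a formal linear combination of partitions.
  coeffₚ : List (K.Carrier × Partition) → Partition → K.Carrier
  coeffₚ []      μ = K.0#
  coeffₚ (x ∷ u) μ = coeffAtₚ μ x K.+ coeffₚ u μ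

  -- A monomial is the list of the indices of its variables.
  Monomial : Set
  Monomial = List ℕ

  mono : Monomial → B
  mono []      = 1#
  mono (n ∷ μ) = var n * mono μ

  degree : Monomial → ℕ
  degree μ = ℕL.sum (map suc μ)

  -- p ∈B≤ n : p is a linear combination of monomials of degree ≤ n.
  infix 4 _∈B≤_
  _∈B≤_ : B → ℤ → Set (c ⊔ ℓ)
  p ∈B≤ n = Σ[ u ∈ List (K.Carrier × Monomial) ]
    All (λ (_ , μ) → + degree μ ℤ.≤ n) u × p ≈ lincomb mono u

  h₀ : ℤ → B
  h₀ (+ zero)  = 1#
  h₀ (+ suc n) = var n
  h₀ -[1+ _ ]  = 0#

  -1^_ : ℕ → B
  -1^ zero  = 1#
  -1^ suc n = ⊖ (-1^ n)

  sign : ℤ → B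
  sign p = -1^ ∣ p ∣

  δ : ℤ → ℤ → B
  δ a b with a ℤₚ.≟ b
  ... | yes _ = 1#
  ... | no  _ = 0#

  -- Laplace expansion along the first row.
  det : ∀ n → (Fin n → Fin n → B) → B
  det zero    M = 1#
  det (suc n) M = sum λ (j : Fin (suc n)) →
    (-1^ toℕ j) * (M zero j * det n λ i k → M (suc i) (punchIn j k))

  record FiniteSupportℕ (f : ℕ → B) : Set (c ⊔ ℓ) where
    constructor finite
    field
      bound    : ℕ
      vanishes : ∀ t → bound ℕ.≤ t → f t ≈ 0#

  ∑ℕ : (f : ℕ → B) → FiniteSupportℕ f → B
  ∑ℕ f fin = sum {FiniteSupportℕ.bound fin} (f ∘ toℕ)

  -- An element is a formal sum of terms b z^m, given as pairs (m , b);
  -- two elements are equal when their coefficients agree.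
  𝓑 : Set c
  𝓑 = List (ℤ × B)

  coeffAt : ℤ → ℤ × B → B
  coeffAt n (m , b) with m ℤₚ.≟ n
  ... | yes _ = b
  ... | no  _ = 0#

  coeff : 𝓑 → ℤ → B
  coeff []      n = 0#
  coeff (x ∷ v) n = coeffAt n x + coeff v n

  infix 4 _≋_
  _≋_ : 𝓑 → 𝓑 → Set (c ⊔ ℓ)
  v ≋ w = ∀ n → coeff v n ≈ coeff w n

  infix 9 _z^_
  _z^_ : B → ℤ → 𝓑
  b z^ m = (m , b) ∷ []

  0𝓑 : 𝓑
  0𝓑 = []

  infixl 6 _⊕_
  _⊕_ : 𝓑 → 𝓑 → 𝓑
  _⊕_ = _++_

  shift : ℤ → 𝓑 → 𝓑
  shift d = map λ (m , b) → (m ℤ.+ d , b)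

  z· z⁻¹· : 𝓑 → 𝓑
  z·   = shift 1ℤ
  z⁻¹· = shift -1ℤ

  -- The map sending b z^m to T m b z^m.
  termwise : (ℤ → B → B) → 𝓑 → 𝓑
  termwise T = map λ (m , b) → (m , T m b)

  -- The extension to 𝓑 of an operator on B, commuting with z^{±1}.
  lift : (B → B) → 𝓑 → 𝓑
  lift T = termwise λ _ → T

  infixr 7 _•_
  _•_ : B → 𝓑 → 𝓑
  b • v = lift (b *_) v

  record FiniteSupportℤ (f : ℤ → 𝓑) : Set (c ⊔ ℓ) where
    constructor finite
    field
      bound    : ℕ
      vanishes : ∀ p → bound ℕ.< ∣ p ∣ → f p ≋ 0𝓑

  -- ∑[-N, N ] f = f(0) + Σ_{n=1}^{N} (f(n) + f(-n))
  ∑[-N,_] : ℕ → (ℤ → 𝓑) → 𝓑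
  ∑[-N, zero ]  f = f 0ℤ
  ∑[-N, suc n ] f = ∑[-N, n ] f ⊕ (f (+ suc n) ⊕ f -[1+ n ])

  ∑ℤ : (f : ℤ → 𝓑) → FiniteSupportℤ f → 𝓑
  ∑ℤ f fin = ∑[-N, FiniteSupportℤ.bound fin ] f

  record IsLinear (T : B → B) : Set (c ⊔ ℓ) where
    field
      cong   : ∀ {x y} → x ≈ y → T x ≈ T y
      +-homo : ∀ x y → T (x + y) ≈ T x + T y
      ·-homo : ∀ a x → T (con a * x) ≈ con a * T x

  private
    open GroupProperties +-group using (inverseˡ-unique; x∙y⁻¹≈ε⇒x≈y)
    open RingProperties ring using (-1*x≈-x; -0#≈0#)
    open import Relation.Binary.Reasoning.Setoid setoid
    module +-SG = SemigroupProperties +-commutativeSemigroup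
    module *-SG = SemigroupProperties *-commutativeSemigroup

    con-neg1 : con (K.- K.1#) ≈ ⊖ 1#
    con-neg1 = inverseˡ-unique _ _
      (trans (sym (con-+ _ _)) (con-cong (K.-‿inverseˡ K.1#)))

  scale : ∀ {i} {I : Set i} → K.Carrier →
          List (K.Carrier × I) → List (K.Carrier × I)
  scale a = map λ (b , x) → (a K.* b , x)

  module _ {i} {I : Set i} (f : I → B) where

    lincomb-++ : ∀ u v → lincomb f (u ++ v) ≈ lincomb f u + lincomb f v
    lincomb-++ []            v = sym (+-identityˡ _)
    lincomb-++ ((a , x) ∷ u) v =
      trans (+-congˡ (lincomb-++ u v)) (sym (+-assoc _ _ _))

    lincomb-scale : ∀ a u → lincomb f (scale a u) ≈ con a * lincomb f u
    lincomb-scale a []            = sym (zeroʳ _)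
    lincomb-scale a ((b , x) ∷ u) = trans
      (+-cong (trans (*-congʳ (con-* a b)) (*-assoc _ _ _))
              (lincomb-scale a u))
      (sym (distribˡ _ _ _))

  without : Partition → List (K.Carrier × Partition) →
            List (K.Carrier × Partition)
  without μ []            = []
  without μ ((a , ν) ∷ u) with ν ≟ₚ μ
  ... | yes _ = without μ u
  ... | no  _ = (a , ν) ∷ without μ u

  length-without : ∀ μ u → length (without μ u) ℕ.≤ length u
  length-without μ []            = z≤n
  length-without μ ((a , ν) ∷ u) with ν ≟ₚ μ
  ... | yes _ = ℕₚ.m≤n⇒m≤1+n (length-without μ u)
  ... | no  _ = s≤s (length-without μ u)

  coeffₚ-without-same : ∀ μ u → coeffₚ (without μ u) μ K.≈ K.0#
  coeffₚ-without-same μ []            = K.refl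
  coeffₚ-without-same μ ((a , ν) ∷ u) with ν ≟ₚ μ
  ... | yes _   = coeffₚ-without-same μ u
  ... | no  ν≢μ with ν ≟ₚ μ
  ...   | yes ν≡μ = ⊥-elim (ν≢μ ν≡μ)
  ...   | no  _   = K.trans (K.+-identityˡ _) (coeffₚ-without-same μ u)

  coeffₚ-without-other : ∀ μ {κ} u → ¬ μ ≡ κ →
                         coeffₚ (without μ u) κ K.≈ coeffₚ u κ
  coeffₚ-without-other μ     []            μ≢κ = K.refl
  coeffₚ-without-other μ {κ} ((a , ν) ∷ u) μ≢κ with ν ≟ₚ μ
  ... | no  _      = K.+-congˡ (coeffₚ-without-other μ u μ≢κ)
  ... | yes ≡.refl with ν ≟ₚ κ
  ...   | yes ν≡κ = ⊥-elim (μ≢κ ν≡κ)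
  ...   | no  _   = K.trans (coeffₚ-without-other μ u μ≢κ)
                            (K.sym (K.+-identityˡ _))

  module _ (T : Partition → B) where

    lincomb-split : ∀ μ u →
      lincomb T u ≈ con (coeffₚ u μ) * T μ + lincomb T (without μ u)
    lincomb-split μ [] = sym (trans (+-identityʳ _) (zeroˡ _))
    lincomb-split μ ((a , ν) ∷ u) with ν ≟ₚ μ
    ... | yes ≡.refl = begin
      con a * T ν + lincomb T u
        ≈⟨ +-congˡ (lincomb-split ν u) ⟩
      con a * T ν + (con (coeffₚ u ν) * T ν + lincomb T (without ν u))
        ≈⟨ +-assoc _ _ _ ⟨
      con a * T ν + con (coeffₚ u ν) * T ν + lincomb T (without ν u)
        ≈⟨ +-congʳ (distribʳ _ _ _) ⟨
      (con a + con (coeffₚ u ν)) * T ν + lincomb T (without ν u)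
        ≈⟨ +-congʳ (*-congʳ (con-+ _ _)) ⟨
      con (a K.+ coeffₚ u ν) * T ν + lincomb T (without ν u) ∎
    ... | no _ = begin
      con a * T ν + lincomb T u
        ≈⟨ +-congˡ (lincomb-split μ u) ⟩
      con a * T ν + (con (coeffₚ u μ) * T μ + lincomb T (without μ u))
        ≈⟨ +-SG.x∙yz≈y∙xz _ _ _ ⟩
      con (coeffₚ u μ) * T μ + (con a * T ν + lincomb T (without μ u))
        ≈⟨ +-congʳ (*-congʳ (con-cong (K.+-identityˡ _))) ⟨
      con (K.0# K.+ coeffₚ u μ) * T μ
        + (con a * T ν + lincomb T (without μ u)) ∎

    lincomb-vanish : ∀ n u → length u ℕ.≤ n →
                     (∀ μ → coeffₚ u μ K.≈ K.0#) → lincomb T u ≈ 0#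
    lincomb-vanish n       []            _       u≈0 = refl
    lincomb-vanish (suc n) ((a , μ) ∷ u) (s≤s l) u≈0 = begin
      lincomb T w
        ≈⟨ lincomb-split μ w ⟩
      con (coeffₚ w μ) * T μ + lincomb T (without μ w)
        ≈⟨ +-cong (trans (*-congʳ (con-cong (u≈0 μ))) (zeroˡ _))
                  (lincomb-vanish n (without μ w) shorter rest≈0) ⟩
      0# + 0#
        ≈⟨ +-identityˡ _ ⟩
      0# ∎
      where
      w = (a , μ) ∷ u

      shorter : length (without μ w) ℕ.≤ n
      shorter with μ ≟ₚ μ
      ... | yes _  = ℕₚ.≤-trans (length-without μ u) l
      ... | no μ≢μ = ⊥-elim (μ≢μ ≡.refl)

      rest≈0 : ∀ κ → coeffₚ (without μ w) κ K.≈ K.0#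
      rest≈0 κ with μ ≟ₚ κ
      ... | yes ≡.refl = coeffₚ-without-same μ w
      ... | no  μ≢κ    = K.trans (coeffₚ-without-other μ w μ≢κ) (u≈0 κ)

  lincomb-transfer : ∀ (S T : Partition → B) →
    (∀ u → lincomb S u ≈ 0# → ∀ μ → coeffₚ u μ K.≈ K.0#) →
    ∀ u v → lincomb S u ≈ lincomb S v → lincomb T u ≈ lincomb T v
  lincomb-transfer S T indep u v Su≈Sv =
    x∙y⁻¹≈ε⇒x≈y _ _ (trans (sym (difference T))
      (lincomb-vanish T (length w) w ℕₚ.≤-refl (indep w
        (trans (difference S)
          (trans (+-congʳ Su≈Sv) (-‿inverseʳ _))))))
    where
    w = u ++ scale (K.- K.1#) v

    difference : ∀ R → lincomb R w ≈ lincomb R u + ⊖ lincomb R v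
    difference R = trans (lincomb-++ R u _) (+-congˡ
      (trans (lincomb-scale R _ v)
        (trans (*-congʳ con-neg1) (-1*x≈-x _))))

  IsLinear-0 : ∀ {T} → IsLinear T → T 0# ≈ 0#
  IsLinear-0 {T} lin = begin
    T 0#        ≈⟨ cong (zeroˡ 0#) ⟨
    T (0# * 0#) ≈⟨ ·-homo _ _ ⟩
    0# * T 0#   ≈⟨ zeroˡ _ ⟩
    0#          ∎
    where open IsLinear lin

  module _ {T : ℤ → B → B} (lin : ∀ m → IsLinear (T m)) where

    coeff-termwise : ∀ v n → coeff (termwise T v) n ≈ T n (coeff v n)
    coeff-termwise []            n = sym (IsLinear-0 (lin n))
    coeff-termwise ((m , b) ∷ v) n =
      trans (+-cong (at m b) (coeff-termwise v n))
            (sym (IsLinear.+-homo (lin n) _ _))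
      where
      at : ∀ m b → coeffAt n (m , T m b) ≈ T n (coeffAt n (m , b))
      at m b with m ℤₚ.≟ n
      ... | yes ≡.refl = refl
      ... | no  _      = sym (IsLinear-0 (lin n))

    termwise-cong : ∀ {v w} → v ≋ w → termwise T v ≋ termwise T w
    termwise-cong {v} {w} v≋w n = begin
      coeff (termwise T v) n ≈⟨ coeff-termwise v n ⟩
      T n (coeff v n)        ≈⟨ IsLinear.cong (lin n) (v≋w n) ⟩
      T n (coeff w n)        ≈⟨ coeff-termwise w n ⟨
      coeff (termwise T w) n ∎

  coeff-shift : ∀ d v n → coeff (shift d v) n ≈ coeff v (n - d)
  coeff-shift d []            n = refl
  coeff-shift d ((m , b) ∷ v) n = +-cong at (coeff-shift d v n)
    where
    at : coeffAt n (m ℤ.+ d , b) ≈ coeffAt (n - d) (m , b)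
    at with m ℤ.+ d ℤₚ.≟ n | m ℤₚ.≟ n - d
    ... | yes _  | yes _  = refl
    ... | no  _  | no  _  = refl
    ... | yes eq | no ¬eq = ⊥-elim (¬eq (≡.trans
            (add-sub m d)
            (≡.cong (_- d) eq)))
    ... | no ¬eq | yes eq = ⊥-elim (¬eq (≡.trans (≡.cong (ℤ._+ d) eq)
            (sub-add n d)))

  shift-cong : ∀ d {v w} → v ≋ w → shift d v ≋ shift d w
  shift-cong d {v} {w} v≋w n = begin
    coeff (shift d v) n ≈⟨ coeff-shift d v n ⟩
    coeff v (n - d)     ≈⟨ v≋w (n - d) ⟩
    coeff w (n - d)     ≈⟨ coeff-shift d w n ⟨
    coeff (shift d w) n ∎

  private
    sum-zero : ∀ {n} (f : Fin n → B) → (∀ i → f i ≈ 0#) → sum f ≈ 0#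
    sum-zero {n} f f≈0 = trans (sum-cong-≋ f≈0) (sum-replicate-zero n)

    punchIn-fromℕ : ∀ n (k : Fin n) → punchIn (fromℕ n) k ≡ inject₁ k
    punchIn-fromℕ (suc n) zero    = ≡.refl
    punchIn-fromℕ (suc n) (suc k) = ≡.cong suc (punchIn-fromℕ n k)

    punchIn-inject₁-fromℕ : ∀ {n} (j : Fin (suc n)) →
      punchIn (inject₁ j) (fromℕ n) ≡ fromℕ (suc n)
    punchIn-inject₁-fromℕ         zero    = ≡.refl
    punchIn-inject₁-fromℕ {suc n} (suc j) =
      ≡.cong suc (punchIn-inject₁-fromℕ j)

    punchIn-inject₁ : ∀ {n} (j : Fin (suc n)) k →
      punchIn (inject₁ j) (inject₁ k) ≡ inject₁ (punchIn j k)
    punchIn-inject₁ zero    k       = ≡.refl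
    punchIn-inject₁ (suc j) zero    = ≡.refl
    punchIn-inject₁ (suc j) (suc k) = ≡.cong suc (punchIn-inject₁ j k)

    vanishˡ : ∀ x y z → y ≈ 0# → x * (y * z) ≈ 0#
    vanishˡ x y z y≈0 =
      trans (*-congˡ (trans (*-congʳ y≈0) (zeroˡ z))) (zeroʳ x)

    vanishʳ : ∀ x y z → z ≈ 0# → x * (y * z) ≈ 0#
    vanishʳ x y z z≈0 =
      trans (*-congˡ (trans (*-congˡ z≈0) (zeroʳ y))) (zeroʳ x)

    minor : ∀ {n} → (Fin (suc n) → Fin (suc n) → B) → Fin (suc n) →
            Fin n → Fin n → B
    minor M j i k = M (suc i) (punchIn j k)

  det-cong : ∀ n {M N : Fin n → Fin n → B} →
             (∀ i j → M i j ≈ N i j) → det n M ≈ det n N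
  det-cong zero    M≈N = refl
  det-cong (suc n) M≈N = sum-cong-≋ λ j → *-congˡ {x = -1^ toℕ j}
    (*-cong (M≈N zero j) (det-cong n λ i k → M≈N (suc i) (punchIn j k)))

  det-zero-row : ∀ n (M : Fin n → Fin n → B) r →
                 (∀ k → M r k ≈ 0#) → det n M ≈ 0#
  det-zero-row (suc n) M zero M≈0 = sum-zero _ λ j →
    vanishˡ (-1^ toℕ j) (M zero j) (det n (minor M j)) (M≈0 j)
  det-zero-row (suc n) M (suc r) M≈0 = sum-zero _ λ j →
    vanishʳ (-1^ toℕ j) (M zero j) (det n (minor M j))
      (det-zero-row n (minor M j) r λ k → M≈0 (punchIn j k))

  det-unit-last-row : ∀ n (M : Fin (suc n) → Fin (suc n) → B) →
    (∀ k → M (fromℕ n) (inject₁ k) ≈ 0#) → M (fromℕ n) (fromℕ n) ≈ 1# →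
    det (suc n) M ≈ det n (λ i j → M (inject₁ i) (inject₁ j))
  det-unit-last-row zero M _ M≈1 = begin
    1# * (M zero zero * 1#) + 0# ≈⟨ +-identityʳ _ ⟩
    1# * (M zero zero * 1#)      ≈⟨ *-identityˡ _ ⟩
    M zero zero * 1#             ≈⟨ *-congʳ M≈1 ⟩
    1# * 1#                      ≈⟨ *-identityˡ _ ⟩
    1#                           ∎
  det-unit-last-row (suc n) M M≈0 M≈1 = begin
    sum t
      ≈⟨ sum-init-last t ⟩
    sum (t ∘ inject₁) + t (fromℕ (suc n))
      ≈⟨ +-cong (sum-cong-≋ term) last≈0 ⟩
    det (suc n) (λ i j → M (inject₁ i) (inject₁ j)) + 0#
      ≈⟨ +-identityʳ _ ⟩
    det (suc n) (λ i j → M (inject₁ i) (inject₁ j)) ∎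
    where
    t : Fin (suc (suc n)) → B
    t j = (-1^ toℕ j) * (M zero j * det (suc n) (minor M j))

    at : ∀ i {k l} → k ≡ l → M i k ≈ M i l
    at i ≡.refl = refl

    last≈0 : t (fromℕ (suc n)) ≈ 0#
    last≈0 = vanishʳ (-1^ toℕ (fromℕ (suc n))) (M zero (fromℕ (suc n)))
      (det (suc n) (minor M (fromℕ (suc n))))
      (det-zero-row (suc n) (minor M (fromℕ (suc n))) (fromℕ n) λ k →
        trans (at (fromℕ (suc n)) (punchIn-fromℕ (suc n) k)) (M≈0 k))

    term : ∀ j → t (inject₁ j) ≈
      (-1^ toℕ j) * (M zero (inject₁ j) *
        det n λ i k → M (inject₁ (suc i)) (inject₁ (punchIn j k)))
    term j = *-cong
      (reflexive (≡.cong -1^_ (Finₚ.toℕ-inject₁ j)))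
      (*-congˡ (trans
        (det-unit-last-row n (minor M (inject₁ j))
          (λ k → trans (at (fromℕ (suc n)) (punchIn-inject₁ j k)) (M≈0 (punchIn j k)))
          (trans (at (fromℕ (suc n)) (punchIn-inject₁-fromℕ j)) M≈1))
        (det-cong n λ i k → at (suc (inject₁ i)) (punchIn-inject₁ j k))))

-- `h r k` is h⁽ʳ⁾_k: the upper index comes first.
record HFamily {c ℓ : Level} (K : CommutativeRing c ℓ) : Set (c ⊔ ℓ) where
  open Polynomials K public
  field
    h        : ℤ → ℤ → B
    h-extend : ∀ k → h 0ℤ k ≈ h₀ k
    h-degree : ∀ r k → h r k ∈B≤ k ℤ.+ r
    h-one    : ∀ k → h k (- k) ≈ 1#
    h-zero   : ∀ r k → k ℤ.+ r ℤ.< 0ℤ → h r k ≈ 0#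

  -- With 0-based i and j the entry h⁽ʲ⁻¹⁾_{λ_i - i + 1} becomes
  -- h⁽ʲ⁾_{λ_{i+1} - i}.
  sDet : ℕ → List ℤ → B
  sDet N xs = det N λ i j → h (+ toℕ j) (part xs (toℕ i) - + toℕ i)

  -- The stable value of `sDet N xs`, attained at N = length xs; see
  -- `sDet-stable`.
  s : List ℤ → B
  s xs = sDet (length xs) xs

  -- e⁽ᵖ⁾_a, with i and j again counted from 0.
  e : ℤ → ℤ → B
  e p a with p - a
  ... | -[1+ _ ]  = 0#
  ... | + zero    = 1#
  ... | + n@(suc _) = det n λ i j →
    h (- p ℤ.+ + suc (toℕ j)) (p ℤ.+ 1ℤ - + suc (toℕ i))

  sDet-stable : ∀ xs d → sDet (d ℕ.+ length xs) xs ≈ s xs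
  sDet-stable xs zero    = refl
  sDet-stable xs (suc d) = trans
    (det-unit-last-row N (entries (suc N))
      (λ k → trans (reflexive (entry (inject₁ k)))
        (h-zero _ _ (subst₂ ℤ._<_
          (≡.sym (≡.trans (ℤₚ.+-comm (- + N) _) (ℤₚ.m-n≡m⊖n _ N)))
          (ℤₚ.n⊖n≡0 N)
          (ℤₚ.⊖-monoˡ-< N (≡.subst (ℕ._< N)
            (≡.sym (Finₚ.toℕ-inject₁ k)) (Finₚ.toℕ<n k))))))
      (trans (reflexive (entry (fromℕ N)))
        (trans (reflexive (≡.cong (λ n → h (+ n) (- + N)) (Finₚ.toℕ-fromℕ N)))
               (h-one (+ N)))))
    (trans
      (det-cong N {N = entries N} λ i j → reflexive (≡.cong₂
        (λ a b → h (+ b) (part xs a - + a))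
        (Finₚ.toℕ-inject₁ i) (Finₚ.toℕ-inject₁ j)))
      (sDet-stable xs d))
    where
    N = d ℕ.+ length xs

    entries : ∀ n → Fin n → Fin n → B
    entries n i j = h (+ toℕ j) (part xs (toℕ i) - + toℕ i)

    entry : ∀ j →
      h (+ toℕ j) (part xs (toℕ (fromℕ N)) - + toℕ (fromℕ N))
        ≡ h (+ toℕ j) (- + N)
    entry j = ≡.cong (h (+ toℕ j)) (≡.trans
      (≡.cong (λ n → part xs n - + n) (Finₚ.toℕ-fromℕ N))
      (≡.trans (≡.cong (_- + N) (part-beyond xs (ℕₚ.m≤n+m _ d)))
               (ℤₚ.+-identityˡ _)))

  sₚ : Partition → B
  sₚ μ = s (vec μ)

record SchurBasis {c ℓ : Level} {K : CommutativeRing c ℓ} (F : HFamily K)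
                  : Set (c ⊔ ℓ) where
  open HFamily F public
  private module K = CommutativeRing K

  field
    expand       : B → List (K.Carrier × Partition)
    expand-sound : ∀ x → lincomb sₚ (expand x) ≈ x
    independent  : ∀ u → lincomb sₚ u ≈ 0# → ∀ μ → coeffₚ u μ K.≈ K.0#

  -- The linear map B → B taking the given values on the basis s_λ; see
  -- `extend-linear` and `extend-basis`.
  extend : (Partition → B) → B → B
  extend T x = lincomb T (expand x)

  extend-linear : ∀ T → IsLinear (extend T)
  extend-linear T = record
    { cong = λ {x} {y} x≈y → transfer (expand x) (expand y)
        (trans (expand-sound x) (trans x≈y (sym (expand-sound y))))
    ; +-homo = λ x y → trans
        (transfer (expand (x + y)) (expand x ++ expand y)
          (trans (expand-sound (x + y)) (sym (trans (lincomb-++ sₚ (expand x) _)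
            (+-cong (expand-sound x) (expand-sound y))))))
        (lincomb-++ T (expand x) _)
    ; ·-homo = λ a x → trans
        (transfer (expand (con a * x)) (scale a (expand x))
          (trans (expand-sound (con a * x)) (sym
            (trans (lincomb-scale sₚ a (expand x)) (*-congˡ (expand-sound x))))))
        (lincomb-scale T a (expand x))
    }
    where transfer = lincomb-transfer sₚ T independent

  extend-basis : ∀ T μ → extend T (sₚ μ) ≈ T μ
  extend-basis T μ = trans
    (lincomb-transfer sₚ T independent (expand (sₚ μ)) ((K.1# , μ) ∷ [])
      (trans (expand-sound (sₚ μ)) (sym (unit sₚ))))
    (unit T)
    where
    unit : ∀ f → lincomb f ((K.1# , μ) ∷ []) ≈ f μ
    unit f = trans (+-identityʳ _) (*-identityˡ _)

  -- In the sums over t the index is shifted to start at 0, so that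
  -- (-1)^{t+1} becomes (-1)^t and λ_t - t becomes λ_{t+1} - (t+1).

  ψ*-term : ℤ → ℤ → Partition → ℕ → B
  ψ*-term k m μ t =
    (-1^ t) * (δ (k - m - 1ℤ) (part (vec μ) t - + suc t)
               * s (remove t (vec μ)))

  ψ*-finite : ∀ k m μ → FiniteSupportℕ (ψ*-term k m μ)
  ψ*-finite k m μ = finite (length (vec μ) ℕ.+ ∣ a ∣) λ t N≤t →
    trans (*-congˡ (trans (*-congʳ (δ≈0 t N≤t)) (zeroˡ _))) (zeroʳ _)
    where
    a = k - m - 1ℤ

    δ≈0 : ∀ t → length (vec μ) ℕ.+ ∣ a ∣ ℕ.≤ t →
          δ a (part (vec μ) t - + suc t) ≈ 0#
    δ≈0 t N≤t with a ℤₚ.≟ (part (vec μ) t - + suc t)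
    ... | no  _  = refl
    ... | yes eq = ⊥-elim (ℕₚ.n≮n t (ℕₚ.≤-trans (ℕₚ.≤-reflexive (≡.sym
            (≡.cong ∣_∣ (≡.trans eq (≡.cong (_- + suc t)
              (part-beyond (vec μ) (ℕₚ.≤-trans (ℕₚ.m≤m+n _ _) N≤t)))))))
            (ℕₚ.≤-trans (ℕₚ.m≤n+m _ _) N≤t)))

  -- 𝓑 has basis s_λ z^m, so the linear extension is made for each m.
  ψ ψ* : ℤ → 𝓑 → 𝓑
  ψ k v = shift 1ℤ
    (termwise (λ m → extend λ μ → s ((k - m - 1ℤ) ∷ vec μ)) v)
  ψ* k v = shift -1ℤ
    (termwise (λ m → extend λ μ → ∑ℕ (ψ*-term k m μ) (ψ*-finite k m μ)) v)

  -- The columns of D_p(s_λ) are 0, …, l with p omitted, i.e. the image of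
  -- `punchIn p`.
  D↓-basis : ℤ → Partition → B
  D↓-basis -[1+ _ ] μ = 0#
  D↓-basis (+ p)    μ with p ℕₚ.≤? length (vec μ)
  ... | no  _   = 0#
  ... | yes p≤l = det (length (vec μ)) λ i j →
    h (+ toℕ (punchIn (fromℕ< (s≤s p≤l)) j))
      (part (vec μ) (toℕ i) - + suc (toℕ i))

  D↑-term : ℤ → Partition → ℕ → B
  D↑-term p μ t =
    (-1^ t) * (h p (part (vec μ) t - + suc t ℤ.+ + 2) * s (remove t (vec μ)))

  D↑-finite : ∀ p μ → FiniteSupportℕ (D↑-term p μ)
  D↑-finite p μ = finite (length (vec μ) ℕ.+ (2 ℕ.+ ∣ p ∣)) λ t N≤t →
    trans (*-congˡ (trans (*-congʳ (h-zero p _ (neg t N≤t))) (zeroˡ _)))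
          (zeroʳ _)
    where
    neg : ∀ t → length (vec μ) ℕ.+ (2 ℕ.+ ∣ p ∣) ℕ.≤ t →
          part (vec μ) t - + suc t ℤ.+ + 2 ℤ.+ p ℤ.< 0ℤ
    neg t N≤t
      rewrite part-beyond (vec μ) (ℕₚ.≤-trans (ℕₚ.m≤m+n _ _) N≤t) =
      subst₂ ℤ._<_ (rearrange (+ suc t) p) (ℤₚ.+-inverseʳ (+ suc t))
        (ℤₚ.+-monoˡ-< (- + suc t) (ℤₚ.≤-<-trans
          (ℤₚ.+-monoʳ-≤ (+ 2) (≤∣∣ p))
          (ℤ.+<+ (s≤s (ℕₚ.≤-trans (ℕₚ.m≤n+m _ _) N≤t)))))
      where
      ≤∣∣ : ∀ i → i ℤ.≤ + ∣ i ∣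
      ≤∣∣ (+ _)    = ℤₚ.≤-refl
      ≤∣∣ -[1+ _ ] = ℤ.-≤+

  -- D↓ p is D_p and D↑ p is D⁽ᵖ⁾.
  D↓ D↑ : ℤ → B → B
  D↓ p = extend (D↓-basis p)
  D↑ p = extend λ μ → ∑ℕ (D↑-term p μ) (D↑-finite p μ)

{-# OPTIONS --safe #-}

-- Laplace expansion of s_(a,λ) along its first row is the formula for ψ_k.
--
-- For ψ*_k, put b = λ_t - t + 2 and a = k - m + 1.  Comparing coefficients of
-- s_(λ_1+1,…,λ_{t-1}+1,λ_{t+1},…) reduces the claim to
--   Σ_p (-1)^p e^(p)_a h^(-p)_b = (-1)^a δ_{a,b}.
-- The terms vanish unless a ≤ p ≤ b.  The matrix defining e^(b)_a is upper
-- Hessenberg with ones below the diagonal, so its first-row expansion expresses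
-- e^(b)_a through the e^(p)_a with a ≤ p < b; this recursion is the relation.
module Submission where

open import Defs
open import Algebra.Bundles using (CommutativeRing)
open import Data.Integer.Base using (ℤ; 1ℤ; -_; _-_) renaming (_+_ to _+ℤ_)
open import Data.Product.Base using (Σ-syntax; _×_)

import Algebra.Properties.CommutativeSemigroup as SemigroupProperties
import Algebra.Properties.Ring as RingProperties
import Algebra.Properties.Semiring.Sum as SemiringSum
open import Data.Empty using (⊥-elim)
open import Data.Fin.Base using (Fin; zero; suc; toℕ; fromℕ<; punchIn)
import Data.Fin.Properties as Finₚ
open import Data.Integer.Base as ℤ using (+_; -[1+_]; 0ℤ; -1ℤ; ∣_∣; _⊖_)
import Data.Integer.Properties as ℤₚ
import Data.Integer.Tactic.RingSolver as ℤ-Solver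
open import Data.List.Base using (List; []; _∷_; map; length)
import Data.List.Properties as Listₚ
open import Data.Nat.Base as ℕ using (ℕ; zero; suc; z≤n; s≤s; _∸_)
import Data.Nat.ListAction as ℕL
import Data.Nat.Properties as ℕₚ
open import Data.Product.Base using (_,_; proj₂)
open import Function.Base using (_∘_)
open import Relation.Binary.PropositionalEquality as ≡ using (_≡_)
open import Relation.Nullary using (yes; no; ¬_)

-- Index arithmetic over the integers.

module Integers where

  i-j-k≡i-k-j : ∀ i j k → i - j - k ≡ i - k - j
  i-j-k≡i-k-j = ℤ-Solver.solve-∀

  subscript-one : ∀ p i → p +ℤ 1ℤ - (1ℤ +ℤ i) ≡ - (- p +ℤ i)
  subscript-one = ℤ-Solver.solve-∀

  degree-below : ∀ p i j → p +ℤ 1ℤ - (1ℤ +ℤ i) +ℤ (- p +ℤ j) ≡ j - i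
  degree-below = ℤ-Solver.solve-∀

  shift-superscript : ∀ p i j → - p +ℤ (i +ℤ j) ≡ - (p - i) +ℤ j
  shift-superscript = ℤ-Solver.solve-∀

  shift-subscript : ∀ p i j → p +ℤ 1ℤ - (i +ℤ j) ≡ p - i +ℤ 1ℤ - j
  shift-subscript = ℤ-Solver.solve-∀

  +suc[i+j] : ∀ i j → + suc (i ℕ.+ j) ≡ + i +ℤ + suc j
  +suc[i+j] i j = ≡.cong +_ (≡.sym (ℕₚ.+-suc i j))

  ⊖≡- : ∀ m n → m ⊖ n ≡ + m - + n
  ⊖≡- m n = ≡.sym (ℤₚ.m-n≡m⊖n m n)

  m⊖[1+m+n]≡-[1+n] : ∀ m n → m ⊖ suc (m ℕ.+ n) ≡ -[1+ n ]
  m⊖[1+m+n]≡-[1+n] m n = ≡.trans (ℤₚ.⊖-< (s≤s (ℕₚ.m≤m+n m n)))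
    (≡.cong (λ k → - (+ k))
      (≡.trans (≡.cong (_∸ m) (≡.sym (ℕₚ.+-suc m n))) (ℕₚ.m+n∸m≡n m (suc n))))

  i<j⇒i-j<0 : ∀ {i j} → i ℤ.< j → i - j ℤ.< 0ℤ
  i<j⇒i-j<0 {i} {j} i<j =
    ≡.subst (i - j ℤ.<_) (ℤₚ.+-inverseʳ j) (ℤₚ.+-monoˡ-< (- j) i<j)

open Integers

-- Determinants with a zero or unit first column, and Hessenberg minors.

module _ {c ℓ} {K : CommutativeRing c ℓ} where
  open Polynomials K
  open SemiringSum (CommutativeRing.semiring polyRing)
    using (sum; sum-cong-≋; sum-replicate-zero; ∑-distrib-+;
           *-distribˡ-sum; *-distribʳ-sum)
  open RingProperties ring using (-‿involutive; -‿distribˡ-*; -‿distribʳ-*)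
  open import Relation.Binary.Reasoning.Setoid setoid
  module +-SG = SemigroupProperties +-commutativeSemigroup
  module *-SG = SemigroupProperties *-commutativeSemigroup

  sum-zero : ∀ {n} (f : Fin n → B) → (∀ i → f i ≈ 0#) → sum f ≈ 0#
  sum-zero {n} f f≈0 = trans (sum-cong-≋ f≈0) (sum-replicate-zero n)

  -- The expansion runs along the first row, so a column needs an induction: the term at column 0
  -- contains a zero entry, and every other minor keeps the zero column as its first.
  det-zero-first-column : ∀ n (M : Fin (suc n) → Fin (suc n) → B) →
    (∀ i → M i zero ≈ 0#) → det (suc n) M ≈ 0#
  det-zero-first-column n M M≈0 = sum-zero _ (term n M M≈0)
    where
    -- Generalised over `n` and `M` so that the clause for `suc j` can expose `n` as a successor, as
    -- the recursive call requires.
    term : ∀ n (M : Fin (suc n) → Fin (suc n) → B) → (∀ i → M i zero ≈ 0#) → ∀ j →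
      (-1^ toℕ j) * (M zero j * det n λ i k → M (suc i) (punchIn j k)) ≈ 0#
    term n M M≈0 zero =
      trans (*-congˡ (trans (*-congʳ (M≈0 zero)) (zeroˡ _))) (zeroʳ _)
    term (suc n) M M≈0 (suc j) =
      trans (*-congˡ (trans (*-congˡ {x = M zero (suc j)} (det-zero-first-column n
        (λ i k → M (suc i) (punchIn (suc j) k)) (λ i → M≈0 (suc i)))) (zeroʳ _))) (zeroʳ _)

  -- Only column 0 survives in the first-row expansion: for any later column, the zeros below the
  -- unit entry form the first column of the minor.
  det-unit-first-column : ∀ n (M : Fin (suc n) → Fin (suc n) → B) →
    M zero zero ≈ 1# → (∀ i → M (suc i) zero ≈ 0#) →
    det (suc n) M ≈ det n (λ i j → M (suc i) (suc j))
  det-unit-first-column n M M≈1 M≈0 = begin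
    1# * (M zero zero * D) + sum tail
      ≈⟨ +-cong (trans (*-identityˡ _) (trans (*-congʳ M≈1) (*-identityˡ _)))
                (sum-zero tail (tail≈0 n M M≈0)) ⟩
    D + 0# ≈⟨ +-identityʳ _ ⟩
    D      ∎
    where
    D = det n (λ i j → M (suc i) (suc j))

    tail : Fin n → B
    tail j = (-1^ suc (toℕ j)) *
      (M zero (suc j) * det n λ i k → M (suc i) (punchIn (suc j) k))

    tail≈0 : ∀ n (M : Fin (suc n) → Fin (suc n) → B) → (∀ i → M (suc i) zero ≈ 0#) →
      ∀ j → (-1^ suc (toℕ j)) *
        (M zero (suc j) * det n λ i k → M (suc i) (punchIn (suc j) k)) ≈ 0#
    tail≈0 (suc n) M M≈0 j =
      trans (*-congˡ (trans (*-congˡ {x = M zero (suc j)} (det-zero-first-column n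
        (λ i k → M (suc i) (punchIn (suc j) k)) M≈0)) (zeroʳ _))) (zeroʳ _)

  -- After deleting row 0 and column j of an upper Hessenberg matrix, the first
  -- j columns are unitriangular and can be stripped off.
  Hessenberg-minor : ∀ n (j : Fin (suc n)) (f : ℕ → ℕ → B) →
    (∀ i → f (suc i) i ≈ 1#) → (∀ {i j} → j ℕ.< i → f (suc i) j ≈ 0#) →
    det n (λ i k → f (suc (toℕ i)) (toℕ (punchIn j k))) ≈
    det (n ∸ toℕ j)
      (λ i k → f (suc (toℕ j ℕ.+ toℕ i)) (suc (toℕ j ℕ.+ toℕ k)))
  Hessenberg-minor n       zero    f f≈1 f≈0 = refl
  Hessenberg-minor (suc n) (suc j) f f≈1 f≈0 = trans
    (det-unit-first-column n (λ i k → f (suc (toℕ i)) (toℕ (punchIn (suc j) k)))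
      (f≈1 0) (λ i → f≈0 (s≤s z≤n)))
    (Hessenberg-minor n j (λ i k → f (suc i) (suc k)) (f≈1 ∘ suc) (f≈0 ∘ s≤s))

  -- Finite sums over initial segments and over symmetric ranges.

  ∑< : ℕ → (ℕ → B) → B
  ∑< n f = sum {n} (f ∘ toℕ)

  ∑<-cong : ∀ n {f g : ℕ → B} → (∀ {j} → j ℕ.< n → f j ≈ g j) → ∑< n f ≈ ∑< n g
  ∑<-cong n f≈g = sum-cong-≋ λ j → f≈g (Finₚ.toℕ<n j)

  ∑<-zero : ∀ n {f : ℕ → B} → (∀ {j} → j ℕ.< n → f j ≈ 0#) → ∑< n f ≈ 0#
  ∑<-zero n f≈0 = sum-zero {n} _ λ j → f≈0 (Finₚ.toℕ<n j)

  ∑<-split : ∀ m n (f : ℕ → B) → ∑< (m ℕ.+ n) f ≈ ∑< m f + ∑< n (λ j → f (m ℕ.+ j))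
  ∑<-split zero    n f = sym (+-identityˡ _)
  ∑<-split (suc m) n f = trans (+-congˡ (∑<-split m n (f ∘ suc))) (sym (+-assoc _ _ _))

  ∑<-last : ∀ n (f : ℕ → B) → ∑< (suc n) f ≈ ∑< n f + f n
  ∑<-last zero    f = +-comm _ _
  ∑<-last (suc n) f = trans (+-congˡ (∑<-last n (f ∘ suc))) (sym (+-assoc _ _ _))

  ∑<-extend : ∀ {m n} (f : ℕ → B) → m ℕ.≤ n → (∀ t → m ℕ.≤ t → f t ≈ 0#) →
              ∑< m f ≈ ∑< n f
  ∑<-extend {m} {n} f m≤n f≈0 = begin
    ∑< m f
      ≈⟨ +-identityʳ _ ⟨
    ∑< m f + 0#
      ≈⟨ +-congˡ (∑<-zero d λ {j} _ → f≈0 (m ℕ.+ j) (ℕₚ.m≤m+n m j)) ⟨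
    ∑< m f + ∑< d (λ j → f (m ℕ.+ j))
      ≈⟨ ∑<-split m d f ⟨
    ∑< (m ℕ.+ d) f
      ≡⟨ ≡.cong (λ k → ∑< k f) (ℕₚ.m+[n∸m]≡n m≤n) ⟩
    ∑< n f ∎
    where d = n ∸ m

  -- The sum over -N ≤ p ≤ N, in descending order.
  ∑± : ℕ → (ℤ → B) → B
  ∑± N f = ∑< (suc (N ℕ.+ N)) λ j → f (N ⊖ j)

  ∣N⊖j∣≤N : ∀ N {j} → j ℕ.< suc (N ℕ.+ N) → ∣ N ⊖ j ∣ ℕ.≤ N
  ∣N⊖j∣≤N N {j} (s≤s j≤2N) with j ℕₚ.≤? N
  ... | yes j≤N rewrite ℤₚ.⊖-≥ j≤N = ℕₚ.m∸n≤m N j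
  ... | no  j≰N rewrite ℤₚ.∣⊖∣-≰ j≰N = ℕₚ.≤-trans (ℕₚ.∸-monoˡ-≤ N j≤2N)
    (ℕₚ.≤-reflexive (ℕₚ.m+n∸n≡m N N))

  ∑±-cong : ∀ N {f g : ℤ → B} → (∀ p → ∣ p ∣ ℕ.≤ N → f p ≈ g p) → ∑± N f ≈ ∑± N g
  ∑±-cong N f≈g = ∑<-cong (suc (N ℕ.+ N)) λ {j} j< → f≈g (N ⊖ j) (∣N⊖j∣≤N N j<)

  -- Matches the recursion of `∑[-N,_]`. In descending order, raising `N` by one adds one term at
  -- the front and one at the end; the middle stays in place because `suc N ⊖ suc j` equals `N ⊖ j`.
  ∑±-suc : ∀ N (f : ℤ → B) → ∑± (suc N) f ≈ ∑± N f + (f (+ suc N) + f -[1+ N ])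
  ∑±-suc N f = begin
    f (+ suc N) + ∑< (suc N ℕ.+ suc N) (λ j → f (suc N ⊖ suc j))
      ≈⟨ +-congˡ (∑<-cong (suc N ℕ.+ suc N) λ {j} _ →
           reflexive (≡.cong f (ℤₚ.[1+m]⊖[1+n]≡m⊖n N j))) ⟩
    f (+ suc N) + ∑< (suc N ℕ.+ suc N) (λ j → f (N ⊖ j))
      ≡⟨ ≡.cong (λ k → f (+ suc N) + ∑< (suc k) (λ j → f (N ⊖ j))) (ℕₚ.+-suc N N) ⟩
    f (+ suc N) + ∑< (suc (suc (N ℕ.+ N))) (λ j → f (N ⊖ j))
      ≈⟨ +-congˡ (∑<-last (suc (N ℕ.+ N)) (λ j → f (N ⊖ j))) ⟩
    f (+ suc N) + (∑± N f + f (N ⊖ suc (N ℕ.+ N)))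
      ≈⟨ +-SG.x∙yz≈y∙xz _ _ _ ⟩
    ∑± N f + (f (+ suc N) + f (N ⊖ suc (N ℕ.+ N)))
      ≡⟨ ≡.cong (λ p → ∑± N f + (f (+ suc N) + f p)) (m⊖[1+m+n]≡-[1+n] N N) ⟩
    ∑± N f + (f (+ suc N) + f -[1+ N ]) ∎

  *-distribˡ-∑± : ∀ N b f → b * ∑± N f ≈ ∑± N λ p → b * f p
  *-distribˡ-∑± N b f = *-distribˡ-sum b λ (j : Fin (suc (N ℕ.+ N))) → f (N ⊖ toℕ j)

  *-distribʳ-∑± : ∀ N b f → ∑± N f * b ≈ ∑± N λ p → f p * b
  *-distribʳ-∑± N b f = *-distribʳ-sum b λ (j : Fin (suc (N ℕ.+ N))) → f (N ⊖ toℕ j)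

  ∑±-zero : ∀ N → ∑± N (λ _ → 0#) ≈ 0#
  ∑±-zero N = ∑<-zero (suc (N ℕ.+ N)) λ _ → refl

  ∑±-+ : ∀ N f g → ∑± N (λ p → f p + g p) ≈ ∑± N f + ∑± N g
  ∑±-+ N f g = ∑-distrib-+ (λ (j : Fin (suc (N ℕ.+ N))) → f (N ⊖ toℕ j)) (λ j → g (N ⊖ toℕ j))

  ∑<-descending : ∀ N (f : ℤ → B) → ∑< (suc N) (λ j → f (N ⊖ j)) ≈ ∑< (suc N) (f ∘ +_)
  ∑<-descending zero    f = refl
  ∑<-descending (suc N) f = begin
    f (+ suc N) + ∑< (suc N) (λ j → f (suc N ⊖ suc j))
      ≈⟨ +-congˡ (∑<-cong (suc N) λ {j} _ →
           reflexive (≡.cong f (ℤₚ.[1+m]⊖[1+n]≡m⊖n N j))) ⟩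
    f (+ suc N) + ∑< (suc N) (λ j → f (N ⊖ j))  ≈⟨ +-congˡ (∑<-descending N f) ⟩
    f (+ suc N) + ∑< (suc N) (f ∘ +_)           ≈⟨ +-comm _ _ ⟩
    ∑< (suc N) (f ∘ +_) + f (+ suc N)           ≈⟨ ∑<-last (suc N) (f ∘ +_) ⟨
    ∑< (suc (suc N)) (f ∘ +_)                   ∎

  ∑±-nonnegative : ∀ {l N} (f : ℤ → B) → l ℕ.≤ N → (∀ n → f -[1+ n ] ≈ 0#) →
    (∀ p → l ℕ.< p → f (+ p) ≈ 0#) → ∑± N f ≈ ∑< (suc l) (f ∘ +_)
  ∑±-nonnegative {l} {N} f l≤N neg≈0 large≈0 = begin
    ∑± N f
      ≈⟨ ∑<-split (suc N) N (λ j → f (N ⊖ j)) ⟩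
    ∑< (suc N) (λ j → f (N ⊖ j)) + ∑< N (λ j → f (N ⊖ suc (N ℕ.+ j)))
      ≈⟨ +-cong (∑<-descending N f) (∑<-zero N λ {j} _ →
           trans (reflexive (≡.cong f (m⊖[1+m+n]≡-[1+n] N j))) (neg≈0 j)) ⟩
    ∑< (suc N) (f ∘ +_) + 0#
      ≈⟨ +-identityʳ _ ⟩
    ∑< (suc N) (f ∘ +_)
      ≈⟨ ∑<-extend (f ∘ +_) (s≤s l≤N) large≈0 ⟨
    ∑< (suc l) (f ∘ +_) ∎

  -- The terms are listed from `b` downwards because the first-row expansion of `e b a` produces
  -- them in that order.
  ∑±-window : ∀ {a b n N} (f : ℤ → B) → b - a ≡ + n → - (+ N) ℤ.≤ a → b ℤ.≤ + N →
    (∀ {p} → p ℤ.< a → f p ≈ 0#) → (∀ {p} → b ℤ.< p → f p ≈ 0#) →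
    ∑± N f ≈ ∑< (suc n) (λ j → f (b - + j))
  ∑±-window {a} {b} {n} {N} f b-a≡n -N≤a b≤N below above = begin
    ∑± N f
      ≡⟨ ≡.cong (λ k → ∑< k g) count ⟩
    ∑< (d ℕ.+ (suc n ℕ.+ r)) g
      ≈⟨ ∑<-split d (suc n ℕ.+ r) g ⟩
    ∑< d g + ∑< (suc n ℕ.+ r) (λ j → g (d ℕ.+ j))
      ≈⟨ +-cong (∑<-zero d λ {j} j<d → above (b<N⊖ j<d))
                (∑<-cong (suc n ℕ.+ r) λ {j} _ → reflexive (≡.cong f (N⊖d+ j))) ⟩
    0# + ∑< (suc n ℕ.+ r) (λ j → f (b - + j))
      ≈⟨ +-identityˡ _ ⟩
    ∑< (suc n ℕ.+ r) (λ j → f (b - + j))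
      ≈⟨ ∑<-extend (λ j → f (b - + j)) (ℕₚ.m≤m+n (suc n) r) (λ t n<t → below (b-t<a n<t)) ⟨
    ∑< (suc n) (λ j → f (b - + j)) ∎
    where
    g : ℕ → B
    g j = f (N ⊖ j)

    -- Of the `2N + 1` terms, `d = N - b` lie above `b`, `n + 1` lie in the window and `r = a + N`
    -- lie below `a`. Both differences are nonnegative by the bounds on `a` and `b`.
    d = ∣ + N - b ∣
    r = ∣ a - - (+ N) ∣

    d≡ : + d ≡ + N - b
    d≡ = ℤₚ.0≤i⇒+∣i∣≡i (ℤₚ.i≤j⇒0≤j-i b≤N)

    r≡ : + r ≡ a - - (+ N)
    r≡ = ℤₚ.0≤i⇒+∣i∣≡i (ℤₚ.i≤j⇒0≤j-i -N≤a)

    count : suc (N ℕ.+ N) ≡ d ℕ.+ (suc n ℕ.+ r)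
    count = ℤₚ.+-injective (≡.trans (lemma (+ N) a b)
      (≡.sym (≡.cong₂ _+ℤ_ d≡ (≡.cong (1ℤ +ℤ_) (≡.cong₂ _+ℤ_ (≡.sym b-a≡n) r≡)))))
      where
      lemma : ∀ N a b → 1ℤ +ℤ (N +ℤ N) ≡ (N - b) +ℤ (1ℤ +ℤ ((b - a) +ℤ (a - - N)))
      lemma = ℤ-Solver.solve-∀

    N⊖d+ : ∀ j → N ⊖ (d ℕ.+ j) ≡ b - + j
    N⊖d+ j = ≡.trans (⊖≡- N (d ℕ.+ j))
      (≡.trans (≡.cong (λ i → + N - (i +ℤ + j)) d≡) (lemma (+ N) b (+ j)))
      where
      lemma : ∀ N b j → N - (N - b +ℤ j) ≡ b - j
      lemma = ℤ-Solver.solve-∀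

    b<N⊖ : ∀ {j} → j ℕ.< d → b ℤ.< N ⊖ j
    b<N⊖ {j} j<d = ≡.subst (ℤ._< N ⊖ j)
      (≡.trans (≡.cong (λ k → N ⊖ k) (≡.sym (ℕₚ.+-identityʳ d)))
        (≡.trans (N⊖d+ 0) (ℤₚ.+-identityʳ b)))
      (ℤₚ.⊖-monoʳ->-< N j<d)

    b-t<a : ∀ {t} → n ℕ.< t → b - + t ℤ.< a
    b-t<a {t} n<t = ≡.subst (b - + t ℤ.<_)
      (≡.trans (≡.cong (λ i → b - i) (≡.sym b-a≡n)) (lemma a b))
      (ℤₚ.+-monoʳ-< b (ℤₚ.neg-mono-< (ℤ.+<+ n<t)))
      where
      lemma : ∀ a b → b - (b - a) ≡ a
      lemma = ℤ-Solver.solve-∀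

  -- Signs and Kronecker deltas.

  ⊖⊖ : ∀ x → x ≈ ⊖ ⊖ x
  ⊖⊖ x = sym (-‿involutive x)

  sign-suc : ∀ i → sign (1ℤ +ℤ i) ≈ ⊖ sign i
  sign-suc (+ n)          = refl
  sign-suc -[1+ zero ]    = ⊖⊖ _
  sign-suc -[1+ suc n ]   = ⊖⊖ _

  sign-minus : ∀ i n → sign (i - + n) ≈ sign i * (-1^ n)
  sign-minus i zero    = trans (reflexive (≡.cong sign (ℤₚ.+-identityʳ i)))
    (trans (sym (*-identityˡ _)) (*-comm _ _))
  sign-minus i (suc n) = begin
    sign (i - + suc n)               ≈⟨ ⊖⊖ _ ⟩
    ⊖ ⊖ sign (i - + suc n)           ≈⟨ -‿cong (sign-suc (i - + suc n)) ⟨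
    ⊖ sign (1ℤ +ℤ (i - + suc n))     ≡⟨ ≡.cong (λ j → ⊖ sign j) (lemma i (+ n)) ⟩
    ⊖ sign (i - + n)                 ≈⟨ -‿cong (sign-minus i n) ⟩
    ⊖ (sign i * (-1^ n))             ≈⟨ -‿distribʳ-* _ _ ⟩
    sign i * (-1^ suc n)             ∎
    where
    lemma : ∀ i n → 1ℤ +ℤ (i - (1ℤ +ℤ n)) ≡ i - n
    lemma = ℤ-Solver.solve-∀

  sign² : ∀ i → sign i * sign i ≈ 1#
  sign² i = square ∣ i ∣
    where
    square : ∀ n → (-1^ n) * (-1^ n) ≈ 1#
    square zero    = *-identityˡ _
    square (suc n) = begin
      ⊖ (-1^ n) * ⊖ (-1^ n)     ≈⟨ -‿distribˡ-* _ _ ⟨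
      ⊖ ((-1^ n) * ⊖ (-1^ n))   ≈⟨ -‿cong (-‿distribʳ-* _ _) ⟨
      ⊖ ⊖ ((-1^ n) * (-1^ n))   ≈⟨ -‿involutive _ ⟩
      (-1^ n) * (-1^ n)         ≈⟨ square n ⟩
      1#                        ∎

  -- Needed because the finite support in the formula for ψ* concerns terms without the outer sign,
  -- while `weight` below includes it.
  sign-cancel : ∀ i {x} → sign i * x ≈ 0# → x ≈ 0#
  sign-cancel i {x} ix≈0 = begin
    x                      ≈⟨ *-identityˡ _ ⟨
    1# * x                 ≈⟨ *-congʳ (sign² i) ⟨
    (sign i * sign i) * x  ≈⟨ *-assoc _ _ _ ⟩
    sign i * (sign i * x)  ≈⟨ *-congˡ ix≈0 ⟩
    sign i * 0#            ≈⟨ zeroʳ _ ⟩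
    0#                     ∎

  δ-yes : ∀ {a b} → a ≡ b → δ a b ≈ 1#
  δ-yes {a} {b} a≡b with a ℤₚ.≟ b
  ... | yes _   = refl
  ... | no  a≢b = ⊥-elim (a≢b a≡b)

  δ-no : ∀ {a b} → ¬ a ≡ b → δ a b ≈ 0#
  δ-no {a} {b} a≢b with a ℤₚ.≟ b
  ... | yes a≡b = ⊥-elim (a≢b a≡b)
  ... | no  _   = refl

  δ-injective : ∀ {a b} (f : ℤ → ℤ) → (f a ≡ f b → a ≡ b) → δ (f a) (f b) ≈ δ a b
  δ-injective {a} {b} f f-inj with a ℤₚ.≟ b
  ... | yes a≡b = δ-yes (≡.cong f a≡b)
  ... | no  a≢b = δ-no (a≢b ∘ f-inj)

  -- Sums of terms with a common power of z.

  coeffAt-cong : ∀ n m {b b′} → b ≈ b′ → coeffAt n (m , b) ≈ coeffAt n (m , b′)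
  coeffAt-cong n m b≈b′ with m ℤₚ.≟ n
  ... | yes _ = b≈b′
  ... | no  _ = refl

  coeffAt-+ : ∀ n m b b′ → coeffAt n (m , b + b′) ≈ coeffAt n (m , b) + coeffAt n (m , b′)
  coeffAt-+ n m b b′ with m ℤₚ.≟ n
  ... | yes _ = refl
  ... | no  _ = sym (+-identityˡ _)

  z^-cong : ∀ {b b′} m → b ≈ b′ → b z^ m ≋ b′ z^ m
  z^-cong m b≈b′ n = +-congʳ (coeffAt-cong n m b≈b′)

  0z^ : ∀ m → 0# z^ m ≋ 0𝓑
  0z^ m n with m ℤₚ.≟ n
  ... | yes _ = +-identityˡ _
  ... | no  _ = +-identityˡ _

  coeff-⊕ : ∀ v w n → coeff (v ⊕ w) n ≈ coeff v n + coeff w n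
  coeff-⊕ []      w n = sym (+-identityˡ _)
  coeff-⊕ (x ∷ v) w n = trans (+-congˡ (coeff-⊕ v w n)) (sym (+-assoc _ _ _))

  -- A sum in `𝓑` is a concatenation of lists. All its terms carry the same exponent here, so
  -- comparing coefficients collapses it to one term and turns the operator formulas into identities
  -- in `B`.
  ∑[-N,]-z^ : ∀ N m g → ∑[-N, N ] (λ p → g p z^ m) ≋ ∑± N g z^ m
  ∑[-N,]-z^ zero    m g n = +-congʳ (coeffAt-cong n m (sym (+-identityʳ _)))
  ∑[-N,]-z^ (suc N) m g n = begin
    coeff (∑[-N, N ] (λ p → g p z^ m) ⊕ (x z^ m ⊕ y z^ m)) n
      ≈⟨ coeff-⊕ (∑[-N, N ] λ p → g p z^ m) (x z^ m ⊕ y z^ m) n ⟩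
    coeff (∑[-N, N ] (λ p → g p z^ m)) n + (at x + (at y + 0#))
      ≈⟨ +-cong (trans (∑[-N,]-z^ N m g n) (+-identityʳ _)) (sym (+-assoc _ _ _)) ⟩
    at (∑± N g) + ((at x + at y) + 0#)
      ≈⟨ +-assoc _ _ _ ⟨
    (at (∑± N g) + (at x + at y)) + 0#
      ≈⟨ +-congʳ (+-congˡ (coeffAt-+ n m x y)) ⟨
    (at (∑± N g) + at (x + y)) + 0#
      ≈⟨ +-congʳ (coeffAt-+ n m (∑± N g) (x + y)) ⟨
    at (∑± N g + (x + y)) + 0#
      ≈⟨ +-congʳ (coeffAt-cong n m (∑±-suc N g)) ⟨
    at (∑± (suc N) g) + 0# ∎
    where
    x = g (+ suc N)
    y = g -[1+ N ]
    at : B → B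
    at b = coeffAt n (m , b)

  •-∑[-N,] : ∀ N b f → b • ∑[-N, N ] f ≡ ∑[-N, N ] λ p → b • f p
  •-∑[-N,] zero    b f = ≡.refl
  •-∑[-N,] (suc N) b f = ≡.trans (Listₚ.map-++ _ (∑[-N, N ] f) _)
    (≡.cong₂ _⊕_ (•-∑[-N,] N b f) (Listₚ.map-++ _ (f (+ suc N)) _))

-- The orthogonality relation between e and h.

module _ {c ℓ} {K : CommutativeRing c ℓ} (F : HFamily K) where
  open HFamily F
  open SemiringSum (CommutativeRing.semiring polyRing)
    using (sum; sum-cong-≋; *-distribˡ-sum)
  open RingProperties ring using (-‿distribˡ-*; -‿distribʳ-*)
  open import Relation.Binary.Reasoning.Setoid setoid

  -- The determinant of size 0 is 1, which is the separate value of `e` at `p = a`; both cases are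
  -- thus handled by one formula.
  e-det : ∀ {p a n} → p - a ≡ + n → e p a ≈ det n λ i j →
    h (- p +ℤ + suc (toℕ j)) (p +ℤ 1ℤ - + suc (toℕ i))
  e-det {p} {a} {n} eq with p - a | eq
  e-det {n = zero}  eq | .(+ zero)  | ≡.refl = refl
  e-det {n = suc n} eq | .(+ suc n) | ≡.refl = refl

  e-below : ∀ {p a} → p ℤ.< a → e p a ≈ 0#
  e-below {p} {a} p<a with p - a | i<j⇒i-j<0 p<a
  ... | -[1+ _ ] | _      = refl
  ... | + _      | ℤ.+<+ ()

  -- Subdiagonal entries have superscript and subscript adding up to zero, so they are 1; entries
  -- further down have negative degree and vanish. Once the unitriangular columns are stripped off,
  -- each minor is again a matrix defining some e with the same `a`.
  e-expand : ∀ {p a n} → p - a ≡ + suc n →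
    e p a ≈ ∑< (suc n) λ j → (-1^ j) * (h (- p +ℤ + suc j) p * e (p - + suc j) a)
  e-expand {p} {a} {n} p-a≡1+n = trans (e-det {p} {a} p-a≡1+n) (sum-cong-≋ λ (j : Fin (suc n)) →
    *-congˡ {x = -1^ toℕ j} (*-cong
      (reflexive (≡.cong (h (- p +ℤ + suc (toℕ j))) (p+1-1≡p p)))
      (begin
        det n (λ i k → f (suc (toℕ i)) (toℕ (punchIn j k)))
          ≈⟨ Hessenberg-minor n j f f≈1 f≈0 ⟩
        det (n ∸ toℕ j) (λ i k → f (suc (toℕ j ℕ.+ toℕ i)) (suc (toℕ j ℕ.+ toℕ k)))
          -- Moving `j + 1` rows down and `j + 1` columns right has the effect of replacing `p` by
          -- `p - (j + 1)` in both indices.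
          ≈⟨ det-cong (n ∸ toℕ j) (λ i k → reflexive (f-shift (toℕ j) (toℕ i) (toℕ k))) ⟩
        det (n ∸ toℕ j) (λ i k → h (- (p - + suc (toℕ j)) +ℤ + suc (toℕ k))
                                   (p - + suc (toℕ j) +ℤ 1ℤ - + suc (toℕ i)))
          ≈⟨ e-det {p - + suc (toℕ j)} {a} (length-minor (ℕₚ.<⇒≤pred (Finₚ.toℕ<n j))) ⟨
        e (p - + suc (toℕ j)) a ∎)))
    where
    f : ℕ → ℕ → B
    f i j = h (- p +ℤ + suc j) (p +ℤ 1ℤ - + suc i)

    p+1-1≡p : ∀ p → p +ℤ 1ℤ - 1ℤ ≡ p
    p+1-1≡p = ℤ-Solver.solve-∀

    f≈1 : ∀ i → f (suc i) i ≈ 1#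
    f≈1 i = trans (reflexive (≡.cong (h _) (subscript-one p (+ suc i)))) (h-one _)

    f≈0 : ∀ {i j} → j ℕ.< i → f (suc i) j ≈ 0#
    f≈0 {i} {j} j<i = h-zero _ _ (≡.subst (ℤ._< 0ℤ)
      (≡.sym (degree-below p (+ suc i) (+ suc j))) (i<j⇒i-j<0 (ℤ.+<+ (s≤s j<i))))

    f-shift : ∀ j i k → f (suc (j ℕ.+ i)) (suc (j ℕ.+ k)) ≡
      h (- (p - + suc j) +ℤ + suc k) (p - + suc j +ℤ 1ℤ - + suc i)
    f-shift j i k = ≡.cong₂ h
      (≡.trans (≡.cong (λ q → - p +ℤ q) (+suc[i+j] (suc j) k)) (shift-superscript p _ _))
      (≡.trans (≡.cong (λ q → p +ℤ 1ℤ - q) (+suc[i+j] (suc j) i)) (shift-subscript p _ _))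

    length-minor : ∀ {j} → j ℕ.≤ n → p - + suc j - a ≡ + (n ∸ j)
    length-minor {j} j≤n = ≡.trans (i-j-k≡i-k-j p (+ suc j) a)
      (≡.trans (≡.cong (_- + suc j) p-a≡1+n)
        (≡.trans (ℤₚ.m-n≡m⊖n (suc n) (suc j))
          (≡.trans (ℤₚ.[1+m]⊖[1+n]≡m⊖n n j) (ℤₚ.⊖-≥ j≤n))))

  he-term : ℤ → ℤ → ℤ → B
  he-term a b p = sign p * (e p a * h (- p) b)

  he-term-below : ∀ a b {p} → p ℤ.< a → he-term a b p ≈ 0#
  he-term-below a b p<a =
    trans (*-congˡ (trans (*-congʳ (e-below p<a)) (zeroˡ _))) (zeroʳ _)

  -- The factor `h (- p) b` has degree at most `b - p`, which is negative.
  he-term-above : ∀ a b {p} → b ℤ.< p → he-term a b p ≈ 0#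
  he-term-above a b {p} b<p =
    trans (*-congˡ (trans (*-congˡ (h-zero (- p) b (i<j⇒i-j<0 b<p))) (zeroʳ _))) (zeroʳ _)

  -- For `a = b` the single term is `sign b`. Otherwise the term at `p = b` is `sign b * e b a`, and
  -- the remaining terms add up to minus its first-row expansion.
  he-sum : ∀ a b {n} → b - a ≡ + n →
    ∑< (suc n) (λ j → he-term a b (b - + j)) ≈ sign a * δ a b
  he-sum a b {zero} b-a≡0 with ℤₚ.i-j≡0⇒i≡j b a b-a≡0
  ... | ≡.refl = begin
    sign (b - 0ℤ) * (e (b - 0ℤ) b * h (- (b - 0ℤ)) b) + 0#
      ≈⟨ +-identityʳ _ ⟩
    he-term b b (b - 0ℤ)
      ≡⟨ ≡.cong (he-term b b) (ℤₚ.+-identityʳ b) ⟩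
    sign b * (e b b * h (- b) b)
      -- `h-one` is used at `k = - b`, hence the double negation in the subscript.
      ≈⟨ *-congˡ (*-cong (e-det {b} {b} b-a≡0) (trans
           (reflexive (≡.cong (h (- b)) (≡.sym (ℤₚ.neg-involutive b)))) (h-one (- b)))) ⟩
    sign b * (1# * 1#)
      ≈⟨ *-congˡ (trans (*-identityˡ _) (sym (δ-yes ≡.refl))) ⟩
    sign b * δ b b ∎
  he-sum a b {suc n} b-a≡1+n = begin
    he-term a b (b - 0ℤ) + ∑< (suc n) (λ j → he-term a b (b - + suc j))
      ≈⟨ +-cong head (sum-cong-≋ {suc n} (λ j → tail (toℕ j))) ⟩
    sign b * e b a + sum {suc n} (λ j → ⊖ sign b * g (toℕ j))
      ≈⟨ +-cong (*-congˡ (e-expand {b} {a} b-a≡1+n))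
           (sym (*-distribˡ-sum (⊖ sign b) λ (j : Fin (suc n)) → g (toℕ j))) ⟩
    sign b * ∑< (suc n) g + ⊖ sign b * ∑< (suc n) g
      ≈⟨ distribʳ _ _ _ ⟨
    (sign b + ⊖ sign b) * ∑< (suc n) g
      ≈⟨ trans (*-congʳ (-‿inverseʳ _)) (zeroˡ _) ⟩
    0#
      ≈⟨ zeroʳ _ ⟨
    sign a * 0#
      ≈⟨ *-congˡ (δ-no a≢b) ⟨
    sign a * δ a b ∎
    where
    g : ℕ → B
    g j = (-1^ j) * (h (- b +ℤ + suc j) b * e (b - + suc j) a)

    a≢b : ¬ a ≡ b
    a≢b ≡.refl with ≡.trans (≡.sym b-a≡1+n) (ℤₚ.+-inverseʳ a)
    ... | ()

    head : he-term a b (b - 0ℤ) ≈ sign b * e b a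
    head = begin
      he-term a b (b - 0ℤ)          ≡⟨ ≡.cong (he-term a b) (ℤₚ.+-identityʳ b) ⟩
      sign b * (e b a * h (- b) b)  ≈⟨ *-congˡ (*-congˡ (trans
           (reflexive (≡.cong (h (- b)) (≡.sym (ℤₚ.neg-involutive b)))) (h-one (- b)))) ⟩
      sign b * (e b a * 1#)         ≈⟨ *-congˡ (trans (*-comm _ _) (*-identityˡ _)) ⟩
      sign b * e b a                ∎

    tail : ∀ j → he-term a b (b - + suc j) ≈ ⊖ sign b * g j
    tail j = begin
      sign (b - + suc j) * (e (b - + suc j) a * h (- (b - + suc j)) b)
        ≈⟨ *-cong (sign-minus b (suc j)) (trans (*-comm _ _) (*-congʳ
             (reflexive (≡.cong (λ r → h r b) (neg-sub b (+ suc j)))))) ⟩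
      (sign b * ⊖ (-1^ j)) * x
        ≈⟨ *-congʳ (trans (sym (-‿distribʳ-* _ _)) (-‿distribˡ-* _ _)) ⟩
      (⊖ sign b * (-1^ j)) * x
        ≈⟨ *-assoc _ _ _ ⟩
      ⊖ sign b * g j ∎
      where
      x = h (- b +ℤ + suc j) b * e (b - + suc j) a
      neg-sub : ∀ b j → - (b - j) ≡ - b +ℤ j
      neg-sub = ℤ-Solver.solve-∀

  he-orthogonal : ∀ {a b N} → - (+ N) ℤ.≤ a → b ℤ.≤ + N →
    ∑± N (he-term a b) ≈ sign a * δ a b
  he-orthogonal {a} {b} {N} -N≤a b≤N with b ℤₚ.<? a
  ... | yes b<a = begin
    ∑± N (he-term a b) ≈⟨ ∑±-cong N (λ p _ → vanishes p) ⟩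
    ∑± N (λ _ → 0#)    ≈⟨ ∑±-zero N ⟩
    0#                 ≈⟨ zeroʳ _ ⟨
    sign a * 0#        ≈⟨ *-congˡ (δ-no (ℤₚ.<⇒≢ b<a ∘ ≡.sym)) ⟨
    sign a * δ a b     ∎
    where
    vanishes : ∀ p → he-term a b p ≈ 0#
    -- With `b < a`, every `p` is below `a` or above `b`.
    vanishes p with p ℤₚ.<? a
    ... | yes p<a = he-term-below a b p<a
    ... | no  p≮a = he-term-above a b (ℤₚ.<-≤-trans b<a (ℤₚ.≮⇒≥ p≮a))
  ... | no b≮a = trans
    (∑±-window (he-term a b) b-a≡n -N≤a b≤N (he-term-below a b) (he-term-above a b))
    (he-sum a b b-a≡n)
    where
    b-a≡n : b - a ≡ + ∣ b - a ∣
    b-a≡n = ≡.sym (ℤₚ.0≤i⇒+∣i∣≡i (ℤₚ.i≤j⇒0≤j-i (ℤₚ.≮⇒≥ b≮a)))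

-- Reduction of an operator formula to the Schur basis.

module _ {c ℓ} {K : CommutativeRing c ℓ} {F : HFamily K} (S : SchurBasis F) where
  open SchurBasis S
  open SemiringSum (CommutativeRing.semiring polyRing)
    using (sum-cong-≋; ∑-comm; *-distribˡ-sum)
  open import Relation.Binary.Reasoning.Setoid setoid
  module K = CommutativeRing K

  -- Adding the bounds gives one `N` that dominates each of them, hence one range of `p` for all
  -- partitions in an expansion.
  total : (Partition → ℕ) → List (K.Carrier × Partition) → ℕ
  total bound u = ℕL.sum (map (bound ∘ proj₂) u)

  -- Common frame for both formulas, with coefficient `w p` and operator values `T p`. Vanishing is
  -- asked of the product because for ψ* very negative `p` are killed by the coefficient and large
  -- `p` by the operator.
  module _ (w : ℤ → B) (T : ℤ → Partition → B) (T′ : Partition → B) (bound : Partition → ℕ)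
    (vanishes : ∀ μ {N p} → bound μ ℕ.≤ N → N ℕ.< ∣ p ∣ → w p * T p μ ≈ 0#)
    (sums : ∀ μ {N} → bound μ ℕ.≤ N → ∑± N (λ p → w p * T p μ) ≈ T′ μ) where

    lincomb-vanishes : ∀ u {N p} → total bound u ℕ.≤ N → N ℕ.< ∣ p ∣ →
      w p * lincomb (T p) u ≈ 0#
    lincomb-vanishes []            _   _   = zeroʳ _
    lincomb-vanishes ((a , μ) ∷ u) {N} {p} b≤N N<p = begin
      w p * (con a * T p μ + lincomb (T p) u)
        ≈⟨ distribˡ _ _ _ ⟩
      w p * (con a * T p μ) + w p * lincomb (T p) u
        ≈⟨ +-cong (trans (*-SG.x∙yz≈y∙xz _ _ _) (*-congˡ
             (vanishes μ (ℕₚ.m+n≤o⇒m≤o (bound μ) b≤N) N<p)))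
             (lincomb-vanishes u (ℕₚ.m+n≤o⇒n≤o (bound μ) b≤N) N<p) ⟩
      con a * 0# + 0#
        ≈⟨ trans (+-identityʳ _) (zeroʳ _) ⟩
      0# ∎

    lincomb-sums : ∀ u {N} → total bound u ℕ.≤ N →
      ∑± N (λ p → w p * lincomb (T p) u) ≈ lincomb T′ u
    lincomb-sums []            {N} _   =
      trans (∑±-cong N λ p _ → zeroʳ (w p)) (∑±-zero N)
    lincomb-sums ((a , μ) ∷ u) {N} b≤N = begin
      ∑± N (λ p → w p * (con a * T p μ + lincomb (T p) u))
        ≈⟨ ∑±-cong N (λ p _ → trans (distribˡ (w p) (con a * T p μ) (lincomb (T p) u))
             (+-congʳ (*-SG.x∙yz≈y∙xz (w p) (con a) (T p μ)))) ⟩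
      ∑± N (λ p → con a * (w p * T p μ) + w p * lincomb (T p) u)
        ≈⟨ ∑±-+ N (λ p → con a * (w p * T p μ)) (λ p → w p * lincomb (T p) u) ⟩
      ∑± N (λ p → con a * (w p * T p μ)) + ∑± N (λ p → w p * lincomb (T p) u)
        ≈⟨ +-cong (trans (sym (*-distribˡ-∑± N (con a) λ p → w p * T p μ))
                         (*-congˡ (sums μ (ℕₚ.m+n≤o⇒m≤o (bound μ) b≤N))))
                  (lincomb-sums u (ℕₚ.m+n≤o⇒n≤o (bound μ) b≤N)) ⟩
      con a * T′ μ + lincomb T′ u ∎

    -- The range depends on `x` through its expansion. The same `N` witnesses the finite support and
    -- carries the sum.
    extend-sums : ∀ x → Σ[ N ∈ ℕ ]
      (∀ p → N ℕ.< ∣ p ∣ → w p * extend (T p) x ≈ 0#) ×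
      ∑± N (λ p → w p * extend (T p) x) ≈ extend T′ x
    extend-sums x = total bound (expand x)
      , (λ p → lincomb-vanishes (expand x) ℕₚ.≤-refl)
      , lincomb-sums (expand x) ℕₚ.≤-refl

  -- The formula for ψ on basis elements.

  D↓-basis-zero : ∀ μ {p} → length (vec μ) ℕ.< ∣ p ∣ → D↓-basis p μ ≈ 0#
  D↓-basis-zero μ { -[1+ _ ]} _   = refl
  D↓-basis-zero μ {+ p}       l<p with p ℕₚ.≤? length (vec μ)
  ... | yes p≤l = ⊥-elim (ℕₚ.<⇒≱ l<p p≤l)
  ... | no  _   = refl

  -- `D↓-basis` takes an integer and rebuilds the omitted column with `fromℕ<`; for an integer
  -- coming from `j` the rebuilt column is `j` itself.
  D↓-basis-minor : ∀ μ (j : Fin (suc (length (vec μ)))) →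
    D↓-basis (+ toℕ j) μ ≈ det (length (vec μ)) λ i k →
      h (+ toℕ (punchIn j k)) (part (vec μ) (toℕ i) - + suc (toℕ i))
  D↓-basis-minor μ j with toℕ j ℕₚ.≤? length (vec μ)
  ... | yes p≤l = reflexive (≡.cong (λ q → det (length (vec μ)) λ i k →
          h (+ toℕ (punchIn q k)) (part (vec μ) (toℕ i) - + suc (toℕ i)))
          (Finₚ.fromℕ<-toℕ j (s≤s p≤l)))
  ... | no  p≰l = ⊥-elim (p≰l (ℕₚ.<⇒≤pred (Finₚ.toℕ<n j)))

  -- Prepending `a` pushes each part of λ down one row, which produces the subscripts `λ_i - i` in
  -- D_p. Thus deleting the first row and column `p` leaves the determinant that defines D_p on the
  -- basis element.
  s-expand-first-row : ∀ a μ {N} → length (vec μ) ℕ.≤ N →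
    ∑± N (λ p → (sign p * h p a) * D↓-basis p μ) ≈ s (a ∷ vec μ)
  s-expand-first-row a μ {N} l≤N = begin
    ∑± N f
      ≈⟨ ∑±-nonnegative f l≤N (λ n → zeroʳ _)
           (λ p l<p → trans (*-congˡ (D↓-basis-zero μ {+ p} l<p)) (zeroʳ _)) ⟩
    ∑< (suc l) (f ∘ +_)
      ≈⟨ sum-cong-≋ {suc l} (λ j → trans (*-assoc _ _ _) (*-congˡ {x = -1^ toℕ j}
           (*-cong (reflexive (≡.cong (h (+ toℕ j)) (≡.sym (ℤₚ.+-identityʳ a))))
                   (D↓-basis-minor μ j)))) ⟩
    s (a ∷ vec μ) ∎
    where
    l = length (vec μ)
    f : ℤ → B
    f p = (sign p * h p a) * D↓-basis p μ

  -- The formula for ψ* on basis elements.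

  part≤sum : ∀ xs t → part (map +_ xs) t ℤ.≤ + ℕL.sum xs
  part≤sum []       t       = ℤₚ.≤-refl
  part≤sum (x ∷ xs) zero    = ℤ.+≤+ (ℕₚ.m≤m+n x _)
  part≤sum (x ∷ xs) (suc t) =
    ℤₚ.≤-trans (part≤sum xs t) (ℤ.+≤+ (ℕₚ.m≤n+m _ x))

  -- This is the index `b` of the orthogonality relation, with `t` counted from 0.
  D↑-index : Partition → ℕ → ℤ
  D↑-index μ t = part (vec μ) t - + suc t +ℤ + 2

  D↑-index≤ : ∀ μ t → D↑-index μ t ℤ.≤ + suc (ℕL.sum (parts μ))
  D↑-index≤ μ t = ≡.subst (ℤ._≤ + suc (ℕL.sum (parts μ)))
    (≡.sym (rearrange (part (vec μ) t) (+ t)))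
    (ℤₚ.≤-trans (ℤₚ.i-j≤i (1ℤ +ℤ part (vec μ) t) (+ t))
                (ℤₚ.+-monoʳ-≤ 1ℤ (part≤sum (parts μ) t)))
    where
    rearrange : ∀ x t → x - (1ℤ +ℤ t) +ℤ + 2 ≡ 1ℤ +ℤ x - t
    rearrange = ℤ-Solver.solve-∀

  D↑-basis : ℤ → Partition → B
  D↑-basis p μ = ∑ℕ (D↑-term p μ) (D↑-finite p μ)

  -- Each summand has a factor `h (- p) b` with `b < p`, hence of negative degree.
  D↑-basis-zero : ∀ μ {p} → + suc (ℕL.sum (parts μ)) ℤ.< p → D↑-basis (- p) μ ≈ 0#
  D↑-basis-zero μ {p} b<p = ∑<-zero (FiniteSupportℕ.bound (D↑-finite (- p) μ)) λ {t} _ →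
    trans (*-congˡ {x = -1^ t} (trans (*-congʳ {x = s (remove t (vec μ))}
      (h-zero (- p) (D↑-index μ t) (i<j⇒i-j<0 (ℤₚ.≤-<-trans (D↑-index≤ μ t) b<p)))) (zeroˡ _))) (zeroʳ _)

  ψ*-basis : ℤ → ℤ → Partition → B
  ψ*-basis k m μ = ∑ℕ (ψ*-term k m μ) (ψ*-finite k m μ)

  -- Orthogonality needs `-N ≤ a` and `b ≤ N` for every `t`; the two summands secure one condition
  -- each.
  D↑-bound : ℤ → Partition → ℕ
  D↑-bound a μ = ∣ a ∣ ℕ.+ suc (ℕL.sum (parts μ))

  -∣i∣≤i : ∀ i → - (+ ∣ i ∣) ℤ.≤ i
  -∣i∣≤i (+ n)    = ℤₚ.neg-≤-pos {n} {n}
  -∣i∣≤i -[1+ n ] = ℤₚ.≤-refl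

  -N≤ : ∀ {a N} → ∣ a ∣ ℕ.≤ N → - (+ N) ℤ.≤ a
  -N≤ {a} a≤N = ℤₚ.≤-trans (ℤₚ.neg-mono-≤ (ℤ.+≤+ a≤N)) (-∣i∣≤i a)

  module _ (k m : ℤ) where

    private
      a : ℤ
      a = k - m +ℤ 1ℤ

    -- The sign in front of the sum over `p` is absorbed here, so that the sum has exactly the value
    -- of ψ*.
    weight : ℤ → B
    weight p = sign a * (sign p * e p a)

    weight-below : ∀ {p} → p ℤ.< a → weight p ≈ 0#
    weight-below p<a =
      trans (*-congˡ (trans (*-congˡ (e-below F p<a)) (zeroʳ _))) (zeroʳ _)

    weight-orthogonal : ∀ μ t {N} → D↑-bound a μ ℕ.≤ N →
      ∑± N (λ p → weight p * h (- p) (D↑-index μ t)) ≈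
      δ (k - m - 1ℤ) (part (vec μ) t - + suc t)
    weight-orthogonal μ t {N} b≤N = begin
      ∑± N (λ p → weight p * h (- p) b)
        ≈⟨ ∑±-cong N (λ p _ → trans (*-assoc (sign a) (sign p * e p a) _)
             (*-congˡ (*-assoc (sign p) (e p a) (h (- p) b)))) ⟩
      ∑± N (λ p → sign a * he-term F a b p)
        ≈⟨ *-distribˡ-∑± N (sign a) (he-term F a b) ⟨
      sign a * ∑± N (he-term F a b)
        ≈⟨ *-congˡ (he-orthogonal F (-N≤ (ℕₚ.m+n≤o⇒m≤o ∣ a ∣ b≤N))
             (ℤₚ.≤-trans (D↑-index≤ μ t) (ℤ.+≤+ (ℕₚ.m+n≤o⇒n≤o ∣ a ∣ b≤N)))) ⟩
      sign a * (sign a * δ a b)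
        ≈⟨ *-assoc _ _ _ ⟨
      (sign a * sign a) * δ a b
        ≈⟨ trans (*-congʳ (sign² a)) (*-identityˡ _) ⟩
      δ a b
        -- Both arguments of the delta in ψ* are 2 less than `a` and `b`, so the common shift by 2
        -- is removed.
        ≡⟨ ≡.cong (λ i → δ i b) (k-m+1≡ k m) ⟩
      δ (k - m - 1ℤ +ℤ + 2) b
        ≈⟨ δ-injective (_+ℤ + 2) (RingProperties.+-cancelʳ ℤₚ.+-*-ring (+ 2) _ _) ⟩
      δ (k - m - 1ℤ) (part (vec μ) t - + suc t) ∎
      where
      b = D↑-index μ t
      k-m+1≡ : ∀ k m → k - m +ℤ 1ℤ ≡ k - m - 1ℤ +ℤ + 2
      k-m+1≡ = ℤ-Solver.solve-∀

    D↑-vanishes : ∀ μ {N p} → D↑-bound a μ ℕ.≤ N → N ℕ.< ∣ p ∣ →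
      weight p * D↑-basis (- p) μ ≈ 0#
    D↑-vanishes μ {N} {+ p}     b≤N N<p = trans (*-congˡ (D↑-basis-zero μ {+ p}
      (ℤ.+<+ (ℕₚ.≤-<-trans (ℕₚ.m+n≤o⇒n≤o ∣ a ∣ b≤N) N<p)))) (zeroʳ _)
    D↑-vanishes μ {N} { -[1+ p ]} b≤N N<p = trans (*-congʳ (weight-below
      (ℤₚ.<-≤-trans (ℤₚ.neg-mono-< (ℤ.+<+ N<p)) (-N≤ {a} (ℕₚ.m+n≤o⇒m≤o ∣ a ∣ b≤N))))) (zeroˡ _)

    -- Interchanging the sums over `p` and `t` leaves, for each `t`, an orthogonality sum that
    -- evaluates to the delta in ψ*.
    D↑-sums : ∀ μ {N} → D↑-bound a μ ℕ.≤ N →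
      ∑± N (λ p → weight p * D↑-basis (- p) μ) ≈ ψ*-basis k m μ
    D↑-sums μ {N} b≤N = begin
      ∑± N (λ p → weight p * D↑-basis (- p) μ)
        ≈⟨ ∑±-cong N (λ p p≤N → *-congˡ {x = weight p}
             (∑<-extend (D↑-term (- p) μ) (D↑-bound≤M p p≤N) (FiniteSupportℕ.vanishes (D↑-finite (- p) μ)))) ⟩
      ∑± N (λ p → weight p * ∑< M (D↑-term (- p) μ))
        ≈⟨ ∑±-cong N (λ p _ → *-distribˡ-sum (weight p)
             λ (t : Fin M) → D↑-term (- p) μ (toℕ t)) ⟩
      ∑± N (λ p → ∑< M λ t → weight p * D↑-term (- p) μ t)
        ≈⟨ ∑-comm (λ (j : Fin (suc (N ℕ.+ N))) (t : Fin M) →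
             weight (N ⊖ toℕ j) * D↑-term (- (N ⊖ toℕ j)) μ (toℕ t)) ⟩
      ∑< M (λ t → ∑± N λ p → weight p * D↑-term (- p) μ t)
        ≈⟨ ∑<-cong M (λ {t} _ → column t) ⟩
      ∑< M (ψ*-term k m μ)
        ≈⟨ ∑<-extend (ψ*-term k m μ) (ℕₚ.m≤n+m _ (l ℕ.+ (2 ℕ.+ N)))
             (FiniteSupportℕ.vanishes (ψ*-finite k m μ)) ⟨
      ψ*-basis k m μ ∎
      where
      l = length (vec μ)

      -- The number of terms of `D↑` varies with `p`; the interchange needs a common length. `M`
      -- exceeds the bound for every `p` in the range as well as the bound for ψ*.
      M = l ℕ.+ (2 ℕ.+ N) ℕ.+ FiniteSupportℕ.bound (ψ*-finite k m μ)

      D↑-bound≤M : ∀ p → ∣ p ∣ ℕ.≤ N → FiniteSupportℕ.bound (D↑-finite (- p) μ) ℕ.≤ M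
      D↑-bound≤M p p≤N = ℕₚ.≤-trans (ℕₚ.+-monoʳ-≤ l (ℕₚ.+-monoʳ-≤ 2
        (ℕₚ.≤-trans (ℕₚ.≤-reflexive (ℤₚ.∣-i∣≡∣i∣ p)) p≤N))) (ℕₚ.m≤m+n _ _)

      column : ∀ t → ∑± N (λ p → weight p * D↑-term (- p) μ t) ≈ ψ*-term k m μ t
      column t = begin
        ∑± N (λ p → weight p * ((-1^ t) * (h (- p) b * r)))
          ≈⟨ ∑±-cong N (λ p _ → trans (*-SG.x∙yz≈y∙xz (weight p) (-1^ t) _)
               (*-congˡ (sym (*-assoc (weight p) (h (- p) b) r)))) ⟩
        ∑± N (λ p → (-1^ t) * ((weight p * h (- p) b) * r))
          ≈⟨ *-distribˡ-∑± N (-1^ t) (λ p → (weight p * h (- p) b) * r) ⟨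
        (-1^ t) * ∑± N (λ p → (weight p * h (- p) b) * r)
          ≈⟨ *-congˡ (*-distribʳ-∑± N r (λ p → weight p * h (- p) b)) ⟨
        (-1^ t) * (∑± N (λ p → weight p * h (- p) b) * r)
          ≈⟨ *-congˡ (*-congʳ (weight-orthogonal μ t b≤N)) ⟩
        ψ*-term k m μ t ∎
        where
        b = D↑-index μ t
        r = s (remove t (vec μ))

-- The two operator formulas.

proposition4p2 : ∀ {c ℓ} (K : CommutativeRing c ℓ) (F : HFamily K) (S : SchurBasis F) →
    let open SchurBasis S in
    ∀ (k m : ℤ) (x : B) →
    (Σ[ fin ∈ FiniteSupportℤ (λ p → sign p • h p (k - m - 1ℤ) • lift (D↓ p) (z· (x z^ m))) ]
    ψ k (x z^ m) ≋ ∑ℤ _ fin)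
    ×
    (Σ[ fin ∈ FiniteSupportℤ (λ p → sign p • e p (k - m +ℤ 1ℤ) • lift (D↑ (- p)) (z⁻¹· (x z^ m))) ]
    ψ* k (x z^ m) ≋ sign (k - m +ℤ 1ℤ) • ∑ℤ _ fin)
proposition4p2 K F S k m x = creation , annihilation
  where
  open SchurBasis S
  open import Relation.Binary.Reasoning.Setoid setoid

  a₁ = k - m - 1ℤ
  a₂ = k - m +ℤ 1ℤ

  creation : Σ[ fin ∈ FiniteSupportℤ (λ p → sign p • h p a₁ • lift (D↓ p) (z· (x z^ m))) ]
    ψ k (x z^ m) ≋ ∑ℤ _ fin
  creation with extend-sums S (λ p → sign p * h p a₁) D↓-basis (λ μ → s (a₁ ∷ vec μ))
    (length ∘ vec)
    (λ μ {N} {p} l≤N N<p →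
      trans (*-congˡ (D↓-basis-zero S μ {p} (ℕₚ.≤-<-trans l≤N N<p))) (zeroʳ _))
    (s-expand-first-row S a₁) x
  ... | N , vanishes , sums =
    finite N (λ p N<p n → trans
      (z^-cong (m +ℤ 1ℤ) (trans (sym (*-assoc _ _ _)) (vanishes p N<p)) n) (0z^ (m +ℤ 1ℤ) n))
    , λ n → begin
      -- On a single term `ψ k` computes to a single term of exponent `m + 1`, so the identity from
      -- `extend-sums` applies to its coefficient directly.
      coeff (ψ k (x z^ m)) n
        ≈⟨ z^-cong (m +ℤ 1ℤ) sums n ⟨
      coeff (∑± N (λ p → (sign p * h p a₁) * D↓ p x) z^ (m +ℤ 1ℤ)) n
        ≈⟨ z^-cong (m +ℤ 1ℤ) (∑±-cong N λ p _ → *-assoc (sign p) (h p a₁) (D↓ p x)) n ⟩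
      coeff (∑± N (λ p → sign p * (h p a₁ * D↓ p x)) z^ (m +ℤ 1ℤ)) n
        ≈⟨ ∑[-N,]-z^ N (m +ℤ 1ℤ) (λ p → sign p * (h p a₁ * D↓ p x)) n ⟨
      coeff (∑[-N, N ] λ p → sign p • h p a₁ • lift (D↓ p) (z· (x z^ m))) n ∎

  annihilation : Σ[ fin ∈ FiniteSupportℤ (λ p → sign p • e p a₂ • lift (D↑ (- p)) (z⁻¹· (x z^ m))) ]
    ψ* k (x z^ m) ≋ sign a₂ • ∑ℤ _ fin
  annihilation with extend-sums S (weight S k m) (λ p → D↑-basis S (- p)) (ψ*-basis S k m)
    (D↑-bound S a₂) (λ μ {N} {p} → D↑-vanishes S k m μ {N} {p}) (D↑-sums S k m) x
  ... | N , vanishes , sums =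
    finite N (λ p N<p n → trans (z^-cong (m +ℤ -1ℤ) (sign-cancel a₂
      (trans (*-congˡ (sym (*-assoc _ _ _))) (trans (sym (*-assoc _ _ _)) (vanishes p N<p)))) n)
      (0z^ (m +ℤ -1ℤ) n))
    , λ n → begin
      coeff (ψ* k (x z^ m)) n
        ≈⟨ z^-cong (m +ℤ -1ℤ) sums n ⟨
      coeff (∑± N (λ p → weight S k m p * D↑ (- p) x) z^ (m +ℤ -1ℤ)) n
        ≈⟨ z^-cong (m +ℤ -1ℤ) (∑±-cong N λ p _ → trans (*-assoc (sign a₂) (sign p * e p a₂) _)
             (*-congˡ (*-assoc (sign p) (e p a₂) (D↑ (- p) x)))) n ⟩
      coeff (∑± N (λ p → sign a₂ * (sign p * (e p a₂ * D↑ (- p) x))) z^ (m +ℤ -1ℤ)) n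
        ≈⟨ ∑[-N,]-z^ N (m +ℤ -1ℤ) (λ p → sign a₂ * (sign p * (e p a₂ * D↑ (- p) x))) n ⟨
      coeff (∑[-N, N ] λ p → sign a₂ • sign p • e p a₂ • lift (D↑ (- p)) (z⁻¹· (x z^ m))) n
        -- Multiplication is a map over the list of terms, so the outer sign leaves the sum by an
        -- equality of lists.
        ≡⟨ ≡.cong (λ v → coeff v n) (•-∑[-N,] N (sign a₂) _) ⟨
      coeff (sign a₂ • ∑[-N, N ] λ p → sign p • e p a₂ • lift (D↑ (- p)) (z⁻¹· (x z^ m))) n ∎
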